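{- Let $n$ be an even positive integer, $q$ a power of a prime, and $u,v$ positive integers with $u\le q$ and $v\le q$. Then the family of all subspaces of $(\mathbb{F}_q)^n$ of dimension $n/2$ is the only maximum-sized subset of $\mathcal{L}_n(q)$ that is both $u$-broom free and $v$-fork free. In particular, the maximum size of a $u$-broom and $v$-fork free family in $\mathcal{L}_n(q)$ is ${n \brack n/2}_q$.
   Context: $\mathcal{L}_n(q)$ is the poset of subspaces of $(\mathbb{F}_q)^n$ ordered by inclusion, where $\mathbb{F}_q$ is the field with $q$ elements. ${n \brack k}_q = \frac{[n]_q!}{[k]_q![n-k]_q!}$ with $[m]_q=\frac{q^m-1}{q-1}$ and $[m]_q!=[m]_q\cdots[1]_q$; it is the number of $k$-dimensional subspaces. A $u$-broom is the poset $\{a_0,\dots,a_u\}$ with $a_i<a_0$ for $1\le i\le u$; a $v$-fork is the poset $\{a_0,\dots,a_v\}$ with $a_0<a_i$ for $1\le i\le v$. A poset $P$ contains $Q$ if there is a subset $P_0\subseteq P$ and a bijection $\theta:Q\to P_0$ with $x\le_Q y\Rightarrow\theta(x)\le_P\theta(y)$ (additional relations allowed); $P$ is $Q$-free otherwise. Subsets carry the induced order. -}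

module Defs where

open import Data.Nat using (ℕ; zero; suc; _+_; _*_; _∸_; _/_; NonZero)
open import Data.Nat.Properties using (m*n≢0)
open import Data.Fin using (Fin; zero; suc)
open import Data.Bool using (Bool; true)
open import Data.Vec using (Vec; []; _∷_; zipWith; map; replicate)
open import Data.List using (List; length; lookup)
open import Data.Product using (Σ; ∃; _×_; _,_)
open import Relation.Binary.PropositionalEquality using (_≡_; _≢_)
open import Relation.Nullary using (¬_)
open import Function.Definitions using (Injective)
open import Algebra.Structures using (IsCommutativeRing)

-- Gaussian binomial coefficients
-- [m]_q = (q^m - 1)/(q - 1) = 1 + q + ... + q^(m-1)   (Horner form)

qint : ℕ → ℕ → ℕ
qint q zero    = 0
qint q (suc m) = suc (q * qint q m)

qfact : ℕ → ℕ → ℕ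
qfact q zero    = 1
qfact q (suc m) = qint q (suc m) * qfact q m

qfact-nz : ∀ q m → NonZero (qfact q m)
qfact-nz q zero    = _
qfact-nz q (suc m) = m*n≢0 (qint q (suc m)) (qfact q m) {{_}} {{qfact-nz q m}}

gauss : ℕ → ℕ → ℕ → ℕ
gauss q n k = _/_ (qfact q n) (qfact q k * qfact q (n ∸ k))
  {{m*n≢0 (qfact q k) (qfact q (n ∸ k)) {{qfact-nz q k}} {{qfact-nz q (n ∸ k)}}}}

-- A finite field with q elements, carried by Fin q (every finite field
-- of order q is isomorphic to one of this form).

record FiniteField (q : ℕ) : Set where
  field
    _+ᶠ_ _*ᶠ_ : Fin q → Fin q → Fin q
    -ᶠ_       : Fin q → Fin q
    0ᶠ 1ᶠ     : Fin q
    isCommutativeRing : IsCommutativeRing _≡_ _+ᶠ_ _*ᶠ_ -ᶠ_ 0ᶠ 1ᶠ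
    0≢1       : 0ᶠ ≢ 1ᶠ
    inverse   : ∀ x → x ≢ 0ᶠ → ∃ λ y → x *ᶠ y ≡ 1ᶠ

module VectorSpace {q : ℕ} (F : FiniteField q) (n : ℕ) where
  open FiniteField F

  V : Set
  V = Vec (Fin q) n

  0ᵛ : V
  0ᵛ = replicate n 0ᶠ

  _+ᵛ_ : V → V → V
  _+ᵛ_ = zipWith _+ᶠ_

  _·ᵛ_ : Fin q → V → V
  c ·ᵛ x = map (c *ᶠ_) x

  lincomb : ∀ {k} → (Fin k → Fin q) → (Fin k → V) → V
  lincomb {zero}  c b = 0ᵛ
  lincomb {suc k} c b = (c zero ·ᵛ b zero) +ᵛ lincomb (λ i → c (suc i)) (λ i → b (suc i))

  record Subspace : Set where
    field
      mem     : V → Bool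
      mem-0   : mem 0ᵛ ≡ true
      mem-+   : ∀ x y → mem x ≡ true → mem y ≡ true → mem (x +ᵛ y) ≡ true
      mem-·   : ∀ c x → mem x ≡ true → mem (c ·ᵛ x) ≡ true
  open Subspace public

  _⊆ˢ_ : Subspace → Subspace → Set
  W ⊆ˢ W′ = ∀ x → mem W x ≡ true → mem W′ x ≡ true

  _≐_ : Subspace → Subspace → Set
  W ≐ W′ = (W ⊆ˢ W′) × (W′ ⊆ˢ W)

  LinIndep : ∀ {k} → (Fin k → V) → Set
  LinIndep b = ∀ c → lincomb c b ≡ 0ᵛ → ∀ i → c i ≡ 0ᶠ

  HasDim : Subspace → ℕ → Set
  HasDim W k = Σ (Fin k → V) λ b →
      LinIndep b
    × (∀ i → mem W (b i) ≡ true)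
    × (∀ x → mem W x ≡ true → ∃ λ c → x ≡ lincomb c b)

  -- a family (subset) of L_n(q), listed without repetition
  Family : Set
  Family = List Subspace

  Distinct : Family → Set
  Distinct 𝓕 = ∀ i j → i ≢ j → ¬ (lookup 𝓕 i ≐ lookup 𝓕 j)

  ContainsBroom : ℕ → Family → Set
  ContainsBroom u 𝓕 = Σ (Fin (suc u) → Fin (length 𝓕)) λ θ →
    Injective _≡_ _≡_ θ × (∀ i → lookup 𝓕 (θ (suc i)) ⊆ˢ lookup 𝓕 (θ zero))

  ContainsFork : ℕ → Family → Set
  ContainsFork v 𝓕 = Σ (Fin (suc v) → Fin (length 𝓕)) λ θ →
    Injective _≡_ _≡_ θ × (∀ i → lookup 𝓕 (θ zero) ⊆ˢ lookup 𝓕 (θ (suc i)))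

  BroomForkFree : ℕ → ℕ → Family → Set
  BroomForkFree u v 𝓕 = Distinct 𝓕 × ¬ ContainsBroom u 𝓕 × ¬ ContainsFork v 𝓕

  IsLevel : ℕ → Family → Set
  IsLevel k 𝓕 = (∀ i → HasDim (lookup 𝓕 i) k)
              × (∀ W → HasDim W k → ∃ λ i → lookup 𝓕 i ≐ W)

{-# OPTIONS --safe #-}

-- Let f k be the number of members of dimension k and p k the number of
-- k-dimensional subspaces that contain a member.  If k < m = n/2, a subspace W counted
-- by p k has [n-k] ≥ [k+2] covers, fewer than q of which are members (all of them
-- lie strictly above a member inside W), while every (k+1)-dimensional subspace
-- covers [k+1] subspaces.  Since [k+2] - (q-1) ≥ 2 [k+1], counting pairs gives
-- f (k+1) + 2 p k ≤ p (k+1), hence f m + 2 Σ_{k<m} f k ≤ p m ≤ N, where N is the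
-- size of the middle level.  Dually f m + 2 Σ_{k>m} f k ≤ N, and the sum of both
-- inequalities is the bound.  The factor 2 makes it possible to treat the lower and
-- the upper half separately, without any matching.  If the bound is attained and the
-- lower half is not empty, then every m-dimensional subspace lies below a member, and
-- this makes the last step of the lower estimate strict.

module Submission where

open import Defs
open import Algebra.Bundles using (CommutativeRing; AbelianGroup)
import Algebra.Properties.AbelianGroup as AbelianGroupProperties
import Algebra.Properties.CommutativeSemigroup as CommutativeSemigroupProperties
import Algebra.Properties.Ring as RingProperties
open import Algebra.Structures using (IsCommutativeRing)
open import Data.Bool using (true; if_then_else_)
import Data.Bool.Properties as Bool
open import Data.Nat
open import Data.Nat.Properties hiding (suc-injective)
open import Algebra.Properties.CommutativeMonoid.Sum +-0-commutativeMonoid using (sum; sum-cong-≗; ∑-distrib-+; ∑-comm)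
open import Algebra.Properties.Semiring.Sum +-*-semiring using (*-distribˡ-sum; *-distribʳ-sum)
open import Data.Fin using (Fin; zero; suc; combine; funToFin; finToFun)
open import Data.Fin.Properties using (any?; all?; suc-injective; funToFin-finToFin; finToFun-funToFin) renaming (_≟_ to _≟ᶠ_)
open import Data.List as List using (List; []; _∷_; _++_; length; filter; deduplicate)
open import Data.List.Membership.Propositional using (_∈_; lose)
open import Data.List.Membership.Propositional.Properties using (∈-lookup; ∈-filter⁺; ∈-++⁺ˡ; ∈-++⁺ʳ; ∈-map⁺; ∈-tabulate⁺)
open import Data.List.Relation.Unary.All as All using (All)
import Data.List.Relation.Unary.All.Properties as All
open import Data.List.Relation.Unary.AllPairs using (AllPairs; _∷_)
import Data.List.Relation.Unary.AllPairs.Properties as AllPairs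
open import Data.List.Relation.Unary.Any as Any using (Any; here; there)
import Data.List.Relation.Unary.Any.Properties as Any
import Data.List.Relation.Unary.Unique.DecSetoid.Properties as Unique
open import Data.Nat.DivMod using (m*n/n≡m)
open import Data.Nat.Induction using (<-rec)
open import Data.Nat.Solver using (module +-*-Solver)
open +-*-Solver using (solve; con; _:=_; _:+_; _:*_)
open import Data.Product using (Σ; ∃; _×_; _,_; proj₁; proj₂; map₂)
open import Data.Unit using (tt)
open import Data.Vec as Vec using (Vec; []; _∷_)
import Data.Vec.Properties as Vec
open import Function using (_∘_; flip)
open import Function.Definitions using (Injective)
open import Level using (0ℓ)
open import Relation.Binary.Bundles using (DecSetoid)
open import Relation.Binary.PropositionalEquality hiding ([_])
open import Relation.Nullary using (¬_; Dec; yes; no; does; contradiction; ¬?; _×-dec_; _→-dec_)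
open import Relation.Nullary.Decidable using (dec-true; map′)
open import Relation.Unary using (Decidable)

-- Counting in Fin n

⟦_⟧ : {A : Set} → Dec A → ℕ
⟦ d ⟧ = if does d then 1 else 0

⟦⟧-mono : {A B : Set} (a : Dec A) (b : Dec B) → (A → B) → ⟦ a ⟧ ≤ ⟦ b ⟧
⟦⟧-mono (no _)  b       f = z≤n
⟦⟧-mono (yes _) (yes _) f = ≤-refl
⟦⟧-mono (yes x) (no ¬y) f = contradiction (f x) ¬y

⟦⟧-× : {A B : Set} (a : Dec A) (b : Dec B) → ⟦ a ×-dec b ⟧ ≡ ⟦ a ⟧ * ⟦ b ⟧
⟦⟧-× (no _)  b       = refl
⟦⟧-× (yes _) (yes _) = refl
⟦⟧-× (yes _) (no _)  = refl

sum-mono : ∀ {n} {f g : Fin n → ℕ} → (∀ i → f i ≤ g i) → sum f ≤ sum g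
sum-mono {zero}  f≤g = z≤n
sum-mono {suc n} f≤g = +-mono-≤ (f≤g zero) (sum-mono (f≤g ∘ suc))

# : ∀ {n} {P : Fin n → Set} → Decidable P → ℕ
# P? = sum (λ i → ⟦ P? i ⟧)

module _ {n : ℕ} {P Q : Fin n → Set} where

  #-mono : (P? : Decidable P) (Q? : Decidable Q) → (∀ i → P i → Q i) → # P? ≤ # Q?
  #-mono P? Q? f = sum-mono (λ i → ⟦⟧-mono (P? i) (Q? i) (f i))

  #-split : (P? : Decidable P) (Q? : Decidable Q) →
    # P? ≡ # (λ i → P? i ×-dec Q? i) + # (λ i → P? i ×-dec ¬? (Q? i))
  #-split P? Q? = trans (sum-cong-≗ (λ i → split (P? i) (Q? i)))
                        (∑-distrib-+ (λ i → ⟦ P? i ×-dec Q? i ⟧) (λ i → ⟦ P? i ×-dec ¬? (Q? i) ⟧))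
    where
    split : {A B : Set} (a : Dec A) (b : Dec B) →
      ⟦ a ⟧ ≡ ⟦ a ×-dec b ⟧ + ⟦ a ×-dec ¬? b ⟧
    split (no _)  b       = refl
    split (yes _) (yes _) = refl
    split (yes _) (no _)  = refl

#-cong : ∀ {n} {P Q : Fin n → Set} (P? : Decidable P) (Q? : Decidable Q) →
  (∀ i → P i → Q i) → (∀ i → Q i → P i) → # P? ≡ # Q?
#-cong P? Q? f g = ≤-antisym (#-mono P? Q? f) (#-mono Q? P? g)

#-all : ∀ n → # {n} (λ _ → yes tt) ≡ n
#-all zero    = refl
#-all (suc n) = cong suc (#-all n)

#-none : ∀ {n} {P : Fin n → Set} (P? : Decidable P) → (∀ i → ¬ P i) → # P? ≡ 0
#-none {zero}  P? ¬p = refl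
#-none {suc n} P? ¬p with P? zero
... | yes p = contradiction p (¬p zero)
... | no  _ = #-none (P? ∘ suc) (¬p ∘ suc)

#-some : ∀ {n} {P : Fin n → Set} (P? : Decidable P) → ∃ P → 1 ≤ # P?
#-some P? (zero , p) with P? zero
... | yes _ = s≤s z≤n
... | no ¬p = contradiction p ¬p
#-some P? (suc i , p) = m≤n⇒m≤o+n ⟦ P? zero ⟧ (#-some (P? ∘ suc) (i , p))

#-unique : ∀ {n} {P : Fin n → Set} (P? : Decidable P) →
  (∀ i j → P i → P j → i ≡ j) → # P? ≤ 1
#-unique {zero}  P? u = z≤n
#-unique {suc n} P? u with P? zero
... | yes p = s≤s (≤-reflexive (#-none (P? ∘ suc) (λ i pi → contradiction (u zero (suc i) p pi) (λ ()))))
... | no  _ = #-unique (P? ∘ suc) (λ i j pi pj → suc-injective (u (suc i) (suc j) pi pj))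

#-select : ∀ {n} {P : Fin n → Set} (P? : Decidable P) u → u ≤ # P? →
  Σ (Fin u → Fin n) λ f → Injective _≡_ _≡_ f × (∀ i → P (f i))
#-select {zero}  P? zero u≤ = (λ ()) , (λ {}) , λ ()
#-select {suc n} P? u u≤ with P? zero
#-select {suc n} P? u u≤ | no _ with #-select (P? ∘ suc) u u≤
... | f , inj , pf = suc ∘ f , inj ∘ suc-injective , pf
#-select {suc n} P? zero u≤ | yes _ = (λ ()) , (λ { {()} }) , λ ()
#-select {suc n} {P} P? (suc u) (s≤s u≤) | yes p with #-select (P? ∘ suc) u u≤
... | f , inj , pf = g , g-inj , pg
  where
  g : Fin (suc u) → Fin (suc n)
  g zero    = zero
  g (suc i) = suc (f i)
  g-inj : Injective _≡_ _≡_ g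
  g-inj {zero}  {zero}  _ = refl
  g-inj {suc i} {suc j} e = cong suc (inj (suc-injective e))
  pg : ∀ i → P (g i)
  pg zero    = p
  pg (suc i) = pf i

#-∃ : ∀ {n} {P : Fin n → Set} (P? : Decidable P) → 1 ≤ # P? → ∃ P
#-∃ P? 1≤ with #-select P? 1 1≤
... | f , _ , pf = f zero , pf zero

module _ {m n : ℕ} {A : Fin m → Set} {B : Fin n → Set} {R : Fin m → Fin n → Set}
         (A? : Decidable A) (B? : Decidable B) (R? : ∀ i j → Dec (R i j)) where

  edges-from : ∀ i → ⟦ A? i ⟧ * # (λ j → B? j ×-dec R? i j)
                   ≡ sum (λ j → ⟦ A? i ⟧ * (⟦ B? j ⟧ * ⟦ R? i j ⟧))
  edges-from i = trans (cong (⟦ A? i ⟧ *_) (sum-cong-≗ (λ j → ⟦⟧-× (B? j) (R? i j))))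
                       (*-distribˡ-sum ⟦ A? i ⟧ (λ j → ⟦ B? j ⟧ * ⟦ R? i j ⟧))

  edges-to : ∀ j → ⟦ B? j ⟧ * # (λ i → A? i ×-dec R? i j)
                 ≡ sum (λ i → ⟦ A? i ⟧ * (⟦ B? j ⟧ * ⟦ R? i j ⟧))
  edges-to j = trans (cong (⟦ B? j ⟧ *_) (sum-cong-≗ (λ i → ⟦⟧-× (A? i) (R? i j))))
              (trans (*-distribˡ-sum ⟦ B? j ⟧ (λ i → ⟦ A? i ⟧ * ⟦ R? i j ⟧))
                     (sum-cong-≗ (λ i → solve 3 (λ a b r → b :* (a :* r) := a :* (b :* r)) refl
                                          ⟦ A? i ⟧ ⟦ B? j ⟧ ⟦ R? i j ⟧)))

  double-count : sum (λ i → ⟦ A? i ⟧ * # (λ j → B? j ×-dec R? i j))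
               ≡ sum (λ j → ⟦ B? j ⟧ * # (λ i → A? i ×-dec R? i j))
  double-count = trans (sum-cong-≗ edges-from)
                (trans (∑-comm (λ i j → ⟦ A? i ⟧ * (⟦ B? j ⟧ * ⟦ R? i j ⟧)))
                       (sym (sum-cong-≗ edges-to)))

  double-count-≤ : ∀ {a b} →
    (∀ i → A i → a ≤ # (λ j → B? j ×-dec R? i j)) →
    (∀ j → B j → # (λ i → A? i ×-dec R? i j) ≤ b) →
    # A? * a ≤ # B? * b
  double-count-≤ {a} {b} lo hi = begin
    # A? * a                                           ≡⟨ *-distribʳ-sum a (λ i → ⟦ A? i ⟧) ⟩
    sum (λ i → ⟦ A? i ⟧ * a)                           ≤⟨ sum-mono (λ i → low (A? i) (lo i)) ⟩
    sum (λ i → ⟦ A? i ⟧ * # (λ j → B? j ×-dec R? i j)) ≡⟨ double-count ⟩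
    sum (λ j → ⟦ B? j ⟧ * # (λ i → A? i ×-dec R? i j)) ≤⟨ sum-mono (λ j → high (B? j) (hi j)) ⟩
    sum (λ j → ⟦ B? j ⟧ * b)                           ≡⟨ sym (*-distribʳ-sum b (λ j → ⟦ B? j ⟧)) ⟩
    # B? * b                                           ∎
    where
    open ≤-Reasoning
    low : {X : Set} {c : ℕ} (d : Dec X) → (X → a ≤ c) → ⟦ d ⟧ * a ≤ ⟦ d ⟧ * c
    low (yes x) h = *-monoʳ-≤ 1 (h x)
    low (no _)  h = z≤n
    high : {X : Set} {c : ℕ} (d : Dec X) → (X → c ≤ b) → ⟦ d ⟧ * c ≤ ⟦ d ⟧ * b
    high (yes x) h = *-monoʳ-≤ 1 (h x)
    high (no _)  h = z≤n

double-count-≡ : ∀ {m n} {A : Fin m → Set} {B : Fin n → Set} {R : Fin m → Fin n → Set}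
  (A? : Decidable A) (B? : Decidable B) (R? : ∀ i j → Dec (R i j)) {a b : ℕ} →
  (∀ i → A i → # (λ j → B? j ×-dec R? i j) ≡ a) →
  (∀ j → B j → # (λ i → A? i ×-dec R? i j) ≡ b) →
  # A? * a ≡ # B? * b
double-count-≡ A? B? R? ea eb = ≤-antisym
  (double-count-≤ A? B? R? (λ i x → ≤-reflexive (sym (ea i x))) (λ j y → ≤-reflexive (eb j y)))
  (double-count-≤ B? A? (λ j i → R? i j) (λ j y → ≤-reflexive (sym (eb j y))) (λ i x → ≤-reflexive (ea i x)))

#-injection : ∀ {u n} {P : Fin n → Set} (P? : Decidable P) (f : Fin u → Fin n) →
  Injective _≡_ _≡_ f → (∀ i → P (f i)) → u ≤ # P?
#-injection {u} P? f inj pf = subst₂ _≤_ (trans (*-identityʳ _) (#-all u)) (*-identityʳ _)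
  -- The pairs (j, i) with `f j ≡ i` are counted: every j has a partner, and injectivity leaves at
  -- most one j for each i. The converse estimate for surjections counts the same pairs from the
  -- other side.
  (double-count-≤ (λ _ → yes tt) P? (λ j i → f j ≟ᶠ i)
    (λ j _ → #-some (λ i → P? i ×-dec f j ≟ᶠ i) (f j , pf j , refl))
    (λ i _ → #-unique (λ j → yes tt ×-dec f j ≟ᶠ i)
               (λ j k (_ , ej) (_ , ek) → inj (trans ej (sym ek)))))

#-surjection : ∀ {u n} {P : Fin n → Set} (P? : Decidable P) (f : Fin u → Fin n) →
  (∀ i → P i → ∃ λ j → f j ≡ i) → # P? ≤ u
#-surjection {u} P? f onto = subst₂ _≤_ (*-identityʳ _) (trans (*-identityʳ _) (#-all u))
  (double-count-≤ P? (λ _ → yes tt) (λ i j → f j ≟ᶠ i)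
    (λ i p → #-some (λ j → yes tt ×-dec f j ≟ᶠ i) (proj₁ (onto i p) , tt , proj₂ (onto i p)))
    (λ j _ → #-unique (λ i → P? i ×-dec f j ≟ᶠ i)
               (λ i k (_ , ei) (_ , ek) → trans (sym ei) ek)))

#-full : ∀ {n} {P Q : Fin n → Set} (P? : Decidable P) (Q? : Decidable Q) →
  (∀ i → P i → Q i) → # Q? ≤ # P? → ∀ i → Q i → P i
#-full {P = P} P? Q? P⊆Q Q≤P i qi with P? i
... | yes pi = pi
-- Such an i would make Q strictly larger than its subset P.
... | no ¬pi = contradiction (#-some Q\P? (i , qi , ¬pi)) (<⇒≱ (s≤s Q\P≤0))
  where
  Q∩P? = λ j → Q? j ×-dec P? j
  Q\P? = λ j → Q? j ×-dec ¬? (P? j)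
  Q\P≤0 : # Q\P? ≤ 0
  Q\P≤0 = +-cancelˡ-≤ (# P?) _ _ (begin
    # P? + # Q\P?     ≡⟨ cong (_+ # Q\P?) (#-cong P? Q∩P? (λ j p → P⊆Q j p , p) (λ _ → proj₂)) ⟩
    # Q∩P? + # Q\P?   ≡⟨ sym (#-split Q? P?) ⟩
    # Q?              ≤⟨ Q≤P ⟩
    # P?              ≡⟨ sym (+-identityʳ _) ⟩
    # P? + 0          ∎)
    where open ≤-Reasoning

-- q-integers

qint-mono : ∀ q {a b} → a ≤ b → qint q a ≤ qint q b
qint-mono q z≤n       = z≤n
qint-mono q (s≤s a≤b) = s≤s (*-monoʳ-≤ q (qint-mono q a≤b))

-- Exact multiples survive integer division, so a product identity found by counting both proves
-- divisibility and identifies the quotient.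
gauss-unique : ∀ q n k x → x * (qfact q k * qfact q (n ∸ k)) ≡ qfact q n → x ≡ gauss q n k
gauss-unique q n k x e = sym (trans (cong (λ t → _/_ t d {{nz}}) (sym e)) (m*n/n≡m x d {{nz}}))
  where
  d = qfact q k * qfact q (n ∸ k)
  nz = m*n≢0 (qfact q k) (qfact q (n ∸ k)) {{qfact-nz q k}} {{qfact-nz q (n ∸ k)}}

-- Ranked posets with the degrees of the subspace lattice

record RankedPoset (q n s : ℕ) : Set₁ where
  field
    _≼_     : Fin s → Fin s → Set
    _≼?_    : ∀ x y → Dec (x ≼ y)
    rk      : Fin s → ℕ
    ≼-trans : ∀ {x y z} → x ≼ y → y ≼ z → x ≼ z
    rk-mono : ∀ {x y} → x ≼ y → rk x ≤ rk y
    rk-eq   : ∀ {x y} → x ≼ y → rk x ≡ rk y → x ≡ y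
    ≼-refl  : ∀ {x} → x ≼ x
    rk≤n    : ∀ x → rk x ≤ n
    up-degree   : ∀ {k} x → rk x ≡ k → k < n →
      # (λ y → (rk y ≟ suc k) ×-dec (x ≼? y)) ≡ qint q (n ∸ k)
    down-degree : ∀ {k} y → rk y ≡ suc k →
      # (λ x → (rk x ≟ k) ×-dec (x ≼? y)) ≡ qint q (suc k)

∸-flip : ∀ {a n k} → a ≤ n → n ∸ a ≡ k → a ≡ n ∸ k
∸-flip a≤n refl = sym (m∸[m∸n]≡n a≤n)

-- Rank k becomes n - k, and the two degree formulas trade places: rank n - k has down-degree [n-k],
-- and rank n - k - 1 has up-degree [k+1]. Results on forks and the lower half thereby apply to
-- brooms and the upper half.
dual : ∀ {q n s} → RankedPoset q n s → RankedPoset q n s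
dual {q} {n} {s} G = record
  { _≼_ = flip _≼_ ; _≼?_ = flip _≼?_ ; rk = λ x → n ∸ rk x
  ; ≼-trans = flip ≼-trans
  ; rk-mono = λ y≼x → ∸-monoʳ-≤ n (rk-mono y≼x)
  ; rk-eq = λ y≼x e → sym (rk-eq y≼x (sym (∸-cancelˡ-≡ (rk≤n _) (rk≤n _) e)))
  ; ≼-refl = ≼-refl
  ; rk≤n = λ x → m∸n≤m n (rk x)
  ; up-degree = λ {k} x e k<n → trans
      (#-cong (λ y → (n ∸ rk y ≟ suc k) ×-dec (y ≼? x)) (λ y → (rk y ≟ n ∸ suc k) ×-dec (y ≼? x))
        (λ y (ey , y≼x) → ∸-flip (rk≤n y) ey , y≼x)
        (λ y (ey , y≼x) → sym (∸-flip k<n (sym ey)) , y≼x))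
      (trans (down-degree x (trans (∸-flip (rk≤n x) e) (pred-∸ k<n)))
             (cong (qint q) (sym (pred-∸ k<n))))
  ; down-degree = λ {k} y e →
      let k<n = subst (_≤ n) e (m∸n≤m n (rk y))
      in trans
      (#-cong (λ x → (n ∸ rk x ≟ k) ×-dec (y ≼? x)) (λ x → (rk x ≟ suc (n ∸ suc k)) ×-dec (y ≼? x))
        (λ x (ex , y≼x) → trans (∸-flip (rk≤n x) ex) (pred-∸ k<n) , y≼x)
        (λ x (ex , y≼x) → sym (∸-flip (<⇒≤ k<n) (trans (pred-∸ k<n) (sym ex))) , y≼x))
      (trans (up-degree y (∸-flip (rk≤n y) e) (∸-monoʳ-< (s≤s z≤n) k<n))
             (cong (qint q) (m∸[m∸n]≡n k<n)))
  }
  where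
  open RankedPoset G
  pred-∸ : ∀ {k} → k < n → n ∸ k ≡ suc (n ∸ suc k)
  pred-∸ {k} k<n = +-∸-assoc 1 k<n

-- Fork-free families

-- Of N covers, c are members and c′ are not. Since c ≤ q - 1 - s, the claim reduces to 1 + q x - (q
-- - 1) - 2 x = (q - 2)(x - 1) ≥ 0.
forkless-arith : ∀ {q c c′ s x N} → 2 ≤ q → 1 ≤ x → c + c′ ≡ N → 1 + q * x ≤ N →
  c + s < q → s + 2 * x ≤ c′
forkless-arith {suc (suc r)} {c} {c′} {s} {suc y} {N} (s≤s (s≤s _)) _ e N≥ (s≤s cs) = +-cancelˡ-≤ c _ _ (begin
  c + (s + 2 * suc y)           ≡⟨ sym (+-assoc c s _) ⟩
  c + s + 2 * suc y             ≤⟨ +-monoˡ-≤ (2 * suc y) cs ⟩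
  1 + r + 2 * suc y             ≡⟨ solve 2 (λ r y → con 1 :+ r :+ y := con 1 :+ (y :+ r)) refl r (2 * suc y) ⟩
  1 + (2 * suc y + r)           ≤⟨ s≤s (+-monoʳ-≤ (2 * suc y) (m≤m*n r (suc y))) ⟩
  1 + (2 * suc y + r * suc y)   ≡⟨ cong suc (sym (*-distribʳ-+ (suc y) 2 r)) ⟩
  1 + suc (suc r) * suc y       ≤⟨ N≥ ⟩
  N                             ≡⟨ sym e ⟩
  c + c′                        ∎)
  where
  open ≤-Reasoning

module Forkless {q n s : ℕ} (G : RankedPoset q n s) (m : ℕ) (n≡m+m : n ≡ m + m) (2≤q : 2 ≤ q)
  {F : Fin s → Set} (F? : Decidable F) where
  open RankedPoset G

  above? : ∀ x → Decidable (λ y → F y × (x ≼ y × x ≢ y))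
  above? x y = F? y ×-dec ((x ≼? y) ×-dec ¬? (x ≟ᶠ y))

  InUpset : ℕ → Fin s → Set
  InUpset k x = rk x ≡ k × ∃ λ w → F w × w ≼ x

  inUpset? : ∀ k → Decidable (InUpset k)
  inUpset? k x = (rk x ≟ k) ×-dec any? (λ w → F? w ×-dec (w ≼? x))

  level-F? : ∀ k → Decidable (λ x → rk x ≡ k × F x)
  level-F? k x = (rk x ≟ k) ×-dec F? x

  below-F? : ∀ k → Decidable (λ x → rk x < k × F x)
  below-F? k x = (rk x <? k) ×-dec F? x

  new? : ∀ k → Decidable (λ x → InUpset k x × ¬ F x)
  new? k x = inUpset? k x ×-dec ¬? (F? x)

  upset-split : ∀ k → # (inUpset? k) ≡ # (level-F? k) + # (new? k)
  upset-split k = trans (#-split (inUpset? k) F?) (cong (_+ # (new? k))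
    (#-cong (λ x → inUpset? k x ×-dec F? x) (level-F? k)
      (λ x ((e , _) , f) → e , f)
      (λ x (e , f) → (e , x , f , ≼-refl) , f)))

  -- Pairs x ≼ y are counted with x in the up-set at rank k and y a nonmember in the up-set at rank
  -- k + 1. From the side of y, at most all [k+1] elements of rank k below it take part.
  edges : ∀ {k} t → (∀ x → InUpset k x → t ≤ # (λ y → new? (suc k) y ×-dec (x ≼? y))) →
    # (inUpset? k) * t ≤ # (new? (suc k)) * qint q (suc k)
  edges {k} t lo = double-count-≤ (inUpset? k) (new? (suc k)) _≼?_ lo
    λ y ((e , _) , _) → ≤-trans
      (#-mono (λ x → inUpset? k x ×-dec (x ≼? y)) (λ x → (rk x ≟ k) ×-dec (x ≼? y))
        (λ x ((ex , _) , x≼y) → ex , x≼y))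
      (≤-reflexive (down-degree y e))

  cover-F? : ∀ k x → Decidable (λ y → (rk y ≡ suc k × x ≼ y) × F y)
  cover-F? k x y = ((rk y ≟ suc k) ×-dec (x ≼? y)) ×-dec F? y

  -- As k < m, x has [n-k] ≥ [k+2] = 1 + q [k+1] covers, and those outside F remain in the up-set
  -- because w lies below them. The reserve t is 0 in the general estimate and 1 in the strict one.
  new-covers : ∀ {k} → k < m → ∀ x → InUpset k x → ∀ t → # (cover-F? k x) + t < q →
    t + 2 * qint q (suc k) ≤ # (λ y → new? (suc k) y ×-dec (x ≼? y))
  new-covers {k} k<m x (ex , w , fw , w≼x) t lt = ≤-trans
    (forkless-arith 2≤q (s≤s z≤n)
      (trans (sym (#-split (λ y → (rk y ≟ suc k) ×-dec (x ≼? y)) F?)) (up-degree x ex k<n))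
      (qint-mono q {suc (suc k)} k+2≤n-k) lt)
    (#-mono (λ y → ((rk y ≟ suc k) ×-dec (x ≼? y)) ×-dec ¬? (F? y)) (λ y → new? (suc k) y ×-dec (x ≼? y))
      (λ y ((ey , x≼y) , ¬f) → ((ey , w , fw , ≼-trans w≼x x≼y) , ¬f) , x≼y))
    where
    k<n : k < n
    k<n = ≤-trans k<m (≤-trans (m≤m+n m m) (≤-reflexive (sym n≡m+m)))
    k+2≤n-k : 2 + k ≤ n ∸ k
    k+2≤n-k = m+n≤o⇒m≤o∸n (2 + k) (begin
      2 + k + k       ≡⟨ cong suc (sym (+-suc k k)) ⟩
      suc k + suc k   ≤⟨ +-mono-≤ k<m k<m ⟩
      m + m           ≡⟨ sym n≡m+m ⟩
      n               ∎)
      where open ≤-Reasoning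

  strictly-above : ∀ {k x y w} → InUpset k x → rk y ≡ suc k → w ≼ x → x ≼ y → w ≢ y
  strictly-above {k} (ex , _) ey w≼x x≼y refl =
    1+n≰n (subst₂ _≤_ ey ex (rk-mono w≼x))

  module _ (forkless : ∀ x → F x → # (above? x) < q) where

    -- One member w below x suffices: the members covering x all lie strictly above w, so the
    -- hypothesis at w bounds them.
    cover-F<q : ∀ {k} x → InUpset k x → # (cover-F? k x) < q
    cover-F<q {k} x p@(_ , w , fw , w≼x) = ≤-<-trans
      (#-mono (cover-F? k x) (above? w)
        (λ y ((ey , x≼y) , fy) → fy , ≼-trans w≼x x≼y , strictly-above p ey w≼x x≼y))
      (forkless w fw)

    step : ∀ {k} → k < m → # (level-F? (suc k)) + 2 * # (inUpset? k) ≤ # (inUpset? (suc k))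
    step {k} k<m = ≤-trans (+-monoʳ-≤ (# (level-F? (suc k))) 2p≤new) (≤-reflexive (sym (upset-split (suc k))))
      where
      open ≤-Reasoning
      p X : ℕ
      p = # (inUpset? k)
      X = qint q (suc k)
      2p≤new : 2 * p ≤ # (new? (suc k))
      2p≤new = *-cancelʳ-≤ _ _ X (begin
        2 * p * X             ≡⟨ solve 2 (λ p x → con 2 :* p :* x := p :* (con 2 :* x)) refl p X ⟩
        p * (2 * X)           ≤⟨ edges (2 * X) (λ x pu → new-covers k<m x pu 0
                                   (subst (_< q) (sym (+-identityʳ _)) (cover-F<q x pu))) ⟩
        # (new? (suc k)) * X  ∎)

    below-suc : ∀ k → # (below-F? (suc k)) ≡ # (below-F? k) + # (level-F? k)
    below-suc k = trans (#-split (below-F? (suc k)) (λ x → rk x <? k)) (cong₂ _+_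
      (#-cong (λ x → below-F? (suc k) x ×-dec (rk x <? k)) (below-F? k)
        (λ x ((_ , f) , l) → l , f) (λ x (l , f) → (m<n⇒m<1+n l , f) , l))
      (#-cong (λ x → below-F? (suc k) x ×-dec ¬? (rk x <? k)) (level-F? k)
        (λ x ((l , f) , ¬l) → ≤-antisym (≤-pred l) (≮⇒≥ ¬l) , f)
        (λ x (e , f) → (s≤s (≤-reflexive e) , f) , λ l → <-irrefl e l)))

    -- Induction on k, intertwined with `below-suc≤upset`. The latter gives up one copy of the
    -- members below rank k to bound all members of rank at most k by the up-set; `step` then
    -- doubles that bound at the next rank.
    below-bound : ∀ k → k ≤ m → # (level-F? k) + 2 * # (below-F? k) ≤ # (inUpset? k)
    below-suc≤upset : ∀ k → k ≤ m → # (below-F? (suc k)) ≤ # (inUpset? k)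

    below-bound zero    _   = ≤-trans (≤-reflexive (trans (cong (λ t → # (level-F? 0) + 2 * t)
      (#-none (below-F? 0) (λ _ ()))) (+-identityʳ _)))
      (≤-trans (m≤m+n _ _) (≤-reflexive (sym (upset-split 0))))
    below-bound (suc k) k<m = ≤-trans
      (+-monoʳ-≤ (# (level-F? (suc k))) (*-monoʳ-≤ 2 (below-suc≤upset k (<⇒≤ k<m))))
      (step k<m)

    below-suc≤upset k k≤m = begin
      # (below-F? (suc k))                     ≡⟨ trans (below-suc k) (+-comm (# (below-F? k)) _) ⟩
      # (level-F? k) + # (below-F? k)          ≤⟨ +-monoʳ-≤ (# (level-F? k)) (m≤m+n _ _) ⟩
      # (level-F? k) + 2 * # (below-F? k)      ≤⟨ below-bound k k≤m ⟩
      # (inUpset? k)                           ∎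
      where open ≤-Reasoning

    -- If every x of rank m lies below a member of F, then each x of rank m - 1
    -- in the up-set has a member of F above it that is not a cover, so it has
    -- one cover in F fewer than in the general estimate.
    below-bound-strict : (∀ x → rk x ≡ m → ∃ λ y → F y × x ≼ y) → 1 ≤ # (below-F? m) →
      # (level-F? m) + 2 * # (below-F? m) < # (inUpset? m)
    below-bound-strict covered 1≤ = go m refl
      where
      open ≤-Reasoning
      go : ∀ k → k ≡ m → # (level-F? k) + 2 * # (below-F? k) < # (inUpset? k)
      go zero    e = contradiction (≤-trans 1≤ (≤-reflexive
        (trans (cong (λ k → # (below-F? k)) (sym e)) (#-none (below-F? 0) (λ _ ()))))) λ ()
      go (suc k) refl = begin-strict
        # (level-F? (suc k)) + 2 * # (below-F? (suc k)) ≤⟨ +-monoʳ-≤ (# (level-F? (suc k))) (*-monoʳ-≤ 2 (below-suc≤upset k (n≤1+n k))) ⟩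
        # (level-F? (suc k)) + 2 * p                    <⟨ +-monoʳ-< (# (level-F? (suc k))) 2p<new ⟩
        # (level-F? (suc k)) + # (new? (suc k))         ≡⟨ sym (upset-split (suc k)) ⟩
        # (inUpset? (suc k))                            ∎
        where
        p X : ℕ
        p = # (inUpset? k)
        X = qint q (suc k)
        -- The general estimate provides a cover z of x outside F. Its rank is m, so some member y
        -- lies above z; y differs from z and therefore has rank greater than m.
        1+cover-F<q : ∀ x → InUpset k x → # (cover-F? k x) + 1 < q
        1+cover-F<q x pu@(ex , w , fw , w≼x) with #-∃ (λ y → new? (suc k) y ×-dec (x ≼? y))
          (≤-trans (s≤s z≤n) (new-covers ≤-refl x pu 0
            (subst (_< q) (sym (+-identityʳ _)) (cover-F<q x pu))))
        ... | z , ((ez , _) , ¬fz) , x≼z with covered z ez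
        -- The members strictly above w are split by whether their rank is k + 1: one part contains
        -- all members covering x, the other contains y.
        ... | y , fy , z≼y = ≤-<-trans
          (≤-trans (+-mono-≤
            (#-mono (cover-F? k x) (λ v → above? w v ×-dec (rk v ≟ suc k))
              (λ v ((ev , x≼v) , fv) → (fv , ≼-trans w≼x x≼v , strictly-above pu ev w≼x x≼v) , ev))
            (#-some (λ v → above? w v ×-dec ¬? (rk v ≟ suc k))
              (y , (fy , ≼-trans w≼x x≼y , w≢y) , rky≢)))
            (≤-reflexive (sym (#-split (above? w) (λ v → rk v ≟ suc k)))))
          (forkless w fw)
          where
          x≼y : x ≼ y
          x≼y = ≼-trans x≼z z≼y
          rky≢ : rk y ≢ suc k
          rky≢ ey = ¬fz (subst F (sym (rk-eq z≼y (trans ez (sym ey)))) fy)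
          w≢y : w ≢ y
          w≢y refl = 1+n≰n (subst₂ _≤_ ez ex (≤-trans (rk-mono z≼y) (rk-mono w≼x)))
        -- Gaining one edge per element makes the estimate strict only if the up-set at rank k is
        -- nonempty.
        1≤p : 1 ≤ p
        1≤p = ≤-trans 1≤ (below-suc≤upset k (n≤1+n k))
        2p<new : 2 * p < # (new? (suc k))
        2p<new = *-cancelʳ-< X _ _ (begin-strict
          2 * p * X                ≡⟨ solve 2 (λ p x → con 2 :* p :* x := p :* (con 2 :* x)) refl p X ⟩
          p * (2 * X)              <⟨ *-monoʳ-< p {{>-nonZero 1≤p}} (n<1+n (2 * X)) ⟩
          p * (1 + 2 * X)          ≤⟨ edges (1 + 2 * X) (λ x pu → new-covers ≤-refl x pu 1 (1+cover-F<q x pu)) ⟩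
          # (new? (suc k)) * X     ∎)

-- Combining the lower and upper halves: the bound and the case of equality

module Middle {q n s : ℕ} (G : RankedPoset q n s) (m : ℕ) (n≡m+m : n ≡ m + m) (2≤q : 2 ≤ q)
  {F : Fin s → Set} (F? : Decidable F) where
  open RankedPoset G
  module Up   = Forkless G m n≡m+m 2≤q F?
  module Down = Forkless (dual G) m n≡m+m 2≤q F?

  n∸m≡m : n ∸ m ≡ m
  n∸m≡m = trans (cong (_∸ m) n≡m+m) (m+n∸n≡m m m)

  rk-dual : ∀ x → n ∸ rk x ≡ m → rk x ≡ m
  rk-dual x e = trans (∸-flip (rk≤n x) e) n∸m≡m

  dual-rk : ∀ x → rk x ≡ m → n ∸ rk x ≡ m
  dual-rk x e = trans (cong (n ∸_) e) n∸m≡m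

  middle? : Decidable (λ x → rk x ≡ m)
  middle? x = rk x ≟ m

  module _ (forkless : ∀ x → F x → # (Up.above? x) < q)
           (broomless : ∀ x → F x → # (Down.above? x) < q) where

    private
      -- Members below, on and above the middle level, and the size of that level; `Down` measures
      -- rank from the top, so its lower half is the upper half here.
      a b c N : ℕ
      a = # (Up.below-F? m)
      b = # (Up.level-F? m)
      c = # (Down.below-F? m)
      N = # middle?

    total : # F? ≡ a + (b + c)
    total = trans (#-split F? (λ x → rk x <? m)) (cong₂ _+_
      (#-cong (λ x → F? x ×-dec (rk x <? m)) (Up.below-F? m) (λ x (f , l) → l , f) (λ x (l , f) → f , l))
      (trans (#-split (λ x → F? x ×-dec ¬? (rk x <? m)) middle?) (cong₂ _+_
        (#-cong (λ x → (F? x ×-dec ¬? (rk x <? m)) ×-dec middle? x) (Up.level-F? m)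
          (λ x ((f , _) , e) → e , f) (λ x (e , f) → (f , <-irrefl e) , e))
        (#-cong (λ x → (F? x ×-dec ¬? (rk x <? m)) ×-dec ¬? (middle? x)) (Down.below-F? m)
          (λ x ((f , ¬l) , ¬e) →
            subst (n ∸ rk x <_) n∸m≡m (∸-monoʳ-< (≤∧≢⇒< (≮⇒≥ ¬l) (¬e ∘ sym)) (rk≤n x)) , f)
          (λ x (l , f) → (f , λ l′ → <⇒≱ l (subst (_≤ n ∸ rk x) n∸m≡m (∸-monoʳ-≤ n (<⇒≤ l′))))
                       , λ e → <-irrefl (dual-rk x e) l)))))

    upset≤ : # (Up.inUpset? m) ≤ N
    upset≤ = #-mono (Up.inUpset? m) middle? (λ _ → proj₁)

    downset≤ : # (Down.inUpset? m) ≤ N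
    downset≤ = #-mono (Down.inUpset? m) middle? (λ x → rk-dual x ∘ proj₁)

    up-bound : b + 2 * a ≤ # (Up.inUpset? m)
    up-bound = Up.below-bound forkless m ≤-refl

    down-bound : b + 2 * c ≤ # (Down.inUpset? m)
    down-bound = subst (λ t → t + 2 * c ≤ # (Down.inUpset? m))
      (#-cong (Down.level-F? m) (Up.level-F? m)
        (λ x (e , f) → rk-dual x e , f) (λ x (e , f) → dual-rk x e , f))
      (Down.below-bound broomless m ≤-refl)

    -- Each half estimate counts its own outer members twice and the middle ones once, so together
    -- they count every member exactly twice.
    size≤ : # F? ≤ N
    size≤ = *-cancelˡ-≤ 2 (begin
      2 * # F?                       ≡⟨ cong (2 *_) total ⟩
      2 * (a + (b + c))              ≡⟨ solve 3 (λ a b c → con 2 :* (a :+ (b :+ c)) := (b :+ con 2 :* a) :+ (b :+ con 2 :* c)) refl a b c ⟩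
      (b + 2 * a) + (b + 2 * c)      ≤⟨ +-mono-≤ (≤-trans up-bound upset≤) (≤-trans down-bound downset≤) ⟩
      N + N                          ≡⟨ solve 1 (λ N → N :+ N := con 2 :* N) refl N ⟩
      2 * N                          ∎)
      where open ≤-Reasoning

    module _ (full : # F? ≡ N) where
      open ≤-Reasoning

      N≡ : N ≡ a + (b + c)
      N≡ = trans (sym full) total

      -- With N = a + b + c, the lower estimate b + 2a ≤ N leaves only a ≤ c. The upper one gives
      -- the reverse, so equality in the bound makes both estimates tight.
      a≤c : a ≤ c
      a≤c = +-cancelˡ-≤ (b + a) _ _ (begin
        b + a + a      ≡⟨ solve 2 (λ a b → b :+ a :+ a := b :+ con 2 :* a) refl a b ⟩
        b + 2 * a      ≤⟨ ≤-trans up-bound upset≤ ⟩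
        N              ≡⟨ N≡ ⟩
        a + (b + c)    ≡⟨ solve 3 (λ a b c → a :+ (b :+ c) := b :+ a :+ c) refl a b c ⟩
        b + a + c      ∎)

      c≤a : c ≤ a
      c≤a = +-cancelˡ-≤ (b + c) _ _ (begin
        b + c + c      ≡⟨ solve 2 (λ a b → b :+ a :+ a := b :+ con 2 :* a) refl c b ⟩
        b + 2 * c      ≤⟨ ≤-trans down-bound downset≤ ⟩
        N              ≡⟨ N≡ ⟩
        a + (b + c)    ≡⟨ +-comm a _ ⟩
        b + c + a      ∎)

      N≡b+2a : N ≡ b + 2 * a
      N≡b+2a = begin-equality
        N              ≡⟨ N≡ ⟩
        a + (b + c)    ≡⟨ cong (λ t → a + (b + t)) (≤-antisym c≤a a≤c) ⟩
        a + (b + a)    ≡⟨ solve 2 (λ a b → a :+ (b :+ a) := b :+ con 2 :* a) refl a b ⟩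
        b + 2 * a      ∎

      -- Tightness of the upper estimate forces the middle elements lying below a member to fill the
      -- whole level.
      covered : ∀ x → rk x ≡ m → ∃ λ y → F y × x ≼ y
      covered x e = proj₂ (#-full (Down.inUpset? m) middle? (λ x → rk-dual x ∘ proj₁) (begin
        N                    ≡⟨ N≡b+2a ⟩
        b + 2 * a            ≤⟨ +-monoʳ-≤ b (*-monoʳ-≤ 2 a≤c) ⟩
        b + 2 * c            ≤⟨ down-bound ⟩
        # (Down.inUpset? m)  ∎) x e)

      -- A nonempty lower half would, by `covered`, make the lower estimate strict, against N = b +
      -- 2a.
      a≡0 : a ≡ 0
      a≡0 = n<1⇒n≡0 (≰⇒> λ 1≤a → <⇒≱ (Up.below-bound-strict forkless covered 1≤a)
        (≤-trans upset≤ (≤-reflexive N≡b+2a)))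

      middle⊆F : ∀ x → rk x ≡ m → F x
      middle⊆F x e = proj₂ (#-full (Up.level-F? m) middle? (λ _ → proj₁) (≤-reflexive (begin-equality
        N          ≡⟨ N≡b+2a ⟩
        b + 2 * a  ≡⟨ cong (λ t → b + 2 * t) a≡0 ⟩
        b + 0      ≡⟨ +-identityʳ b ⟩
        b          ∎)) x e)

      F⊆middle : ∀ x → F x → rk x ≡ m
      F⊆middle = #-full middle? F? middle⊆F (≤-reflexive full)

-- Level sizes and down-degrees from the degrees in intervals

record GradedPoset (q n s : ℕ) : Set₁ where
  field
    _≼_     : Fin s → Fin s → Set
    _≼?_    : ∀ x y → Dec (x ≼ y)
    rk      : Fin s → ℕ
    ≼-trans : ∀ {x y z} → x ≼ y → y ≼ z → x ≼ z
    rk-mono : ∀ {x y} → x ≼ y → rk x ≤ rk y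
    rk-eq   : ∀ {x y} → x ≼ y → rk x ≡ rk y → x ≡ y
    ≼-refl  : ∀ {x} → x ≼ x
    bot top : Fin s
    rk-bot  : rk bot ≡ 0
    rk-top  : rk top ≡ n
    bot-≼   : ∀ x → bot ≼ x
    ≼-top   : ∀ x → x ≼ top
    interval-degree : ∀ {k} x z → rk x ≡ k → x ≼ z → k < rk z →
      # (λ y → ((rk y ≟ suc k) ×-dec (y ≼? z)) ×-dec (x ≼? y)) ≡ qint q (rk z ∸ k)

module Gaussian {q n s : ℕ} (G : GradedPoset q n s) where
  open GradedPoset G

  within? : ∀ k z → Decidable (λ x → rk x ≡ k × x ≼ z)
  within? k z x = (rk x ≟ k) ×-dec (x ≼? z)

  DownDegree : ℕ → Set
  DownDegree d = ∀ z → rk z ≡ suc d → # (within? d z) ≡ qint q (suc d)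

  -- Induction on k. Counting edges between ranks k and k + 1 below z gives g(k) [d-k] = g(k+1)
  -- [k+1], where d is the rank of z. The right side needs down-degrees only at ranks k + 1 < d,
  -- which is why the hypothesis stops there.
  within-count : ∀ z → (∀ j → suc j < rk z → DownDegree j) → ∀ k → k < rk z →
    # (within? k z) * (qfact q k * qfact q (rk z ∸ k)) ≡ qfact q (rk z)
  within-count z down zero _ = begin
    # (within? 0 z) * (1 * qfact q (rk z))  ≡⟨ cong (_* (1 * qfact q (rk z))) one ⟩
    1 * (1 * qfact q (rk z))                ≡⟨ trans (*-identityˡ _) (*-identityˡ _) ⟩
    qfact q (rk z)                          ∎
    where
    open ≡-Reasoning
    is-bot : ∀ x → rk x ≡ 0 → bot ≡ x
    is-bot x e = rk-eq (bot-≼ x) (trans rk-bot (sym e))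
    one : # (within? 0 z) ≡ 1
    one = ≤-antisym
      (#-unique (within? 0 z) (λ x y (ex , _) (ey , _) → trans (sym (is-bot x ex)) (is-bot y ey)))
      (#-some (within? 0 z) (bot , rk-bot , bot-≼ z))
  within-count z down (suc k) k+1<d = begin
    # (within? (suc k) z) * (qint q (suc k) * qfact q k * e!)
      ≡⟨ solve 4 (λ g x y w → g :* (x :* y :* w) := g :* x :* (y :* w)) refl (# (within? (suc k) z)) (qint q (suc k)) (qfact q k) e! ⟩
    # (within? (suc k) z) * qint q (suc k) * (qfact q k * e!)
      ≡⟨ cong (_* (qfact q k * e!)) (sym level-edges) ⟩
    # (within? k z) * qint q (rk z ∸ k) * (qfact q k * e!)
      ≡⟨ solve 4 (λ g x y w → g :* x :* (y :* w) := g :* (y :* (x :* w))) refl (# (within? k z)) (qint q (rk z ∸ k)) (qfact q k) e! ⟩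
    # (within? k z) * (qfact q k * (qint q (rk z ∸ k) * e!))
      ≡⟨ cong (λ t → # (within? k z) * (qfact q k * t)) (sym unfold) ⟩
    # (within? k z) * (qfact q k * qfact q (rk z ∸ k))
      ≡⟨ within-count z down k k<d ⟩
    qfact q (rk z) ∎
    where
    open ≡-Reasoning
    k<d : k < rk z
    k<d = <⇒≤ k+1<d
    e! = qfact q (rk z ∸ suc k)
    unfold : qfact q (rk z ∸ k) ≡ qint q (rk z ∸ k) * e!
    unfold rewrite +-∸-assoc 1 k<d = refl
    level-edges : # (within? k z) * qint q (rk z ∸ k) ≡ # (within? (suc k) z) * qint q (suc k)
    level-edges = double-count-≡ (within? k z) (within? (suc k) z) _≼?_
      (λ x (ex , x≼z) → interval-degree x z ex x≼z k<d)
      (λ y (ey , y≼z) → trans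
        (#-cong (λ x → within? k z x ×-dec (x ≼? y)) (within? k y)
          (λ x ((ex , _) , x≼y) → ex , x≼y) (λ x (ex , x≼y) → (ex , ≼-trans x≼y y≼z) , x≼y))
        (down k k+1<d y ey))

  -- Strong induction: below an element of rank d + 1, the previous count at level d needs
  -- down-degrees of smaller ranks only. It reads g [d]! [1]! = [d+1]!, and cancelling [d]! leaves
  -- [d+1].
  down-degree : ∀ d → DownDegree d
  down-degree = <-rec DownDegree λ d down z e →
    let instance nz = qfact-nz q d in
    *-cancelʳ-≡ _ _ (qfact q d) (begin
      # (within? d z) * qfact q d
        ≡⟨ cong (# (within? d z) *_) (sym (trans (cong (λ t → qfact q d * qfact q t)
             (trans (cong (_∸ d) e) (m+n∸n≡m 1 d))) (trans (cong (qfact q d *_) 1!≡1) (*-identityʳ _)))) ⟩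
      # (within? d z) * (qfact q d * qfact q (rk z ∸ d))
        ≡⟨ within-count z (λ j l → down (≤-pred (subst (suc j <_) e l))) d (≤-reflexive (sym e)) ⟩
      qfact q (rk z)
        ≡⟨ cong (qfact q) e ⟩
      qint q (suc d) * qfact q d ∎)
    where
    open ≡-Reasoning
    1!≡1 : qfact q 1 ≡ 1
    1!≡1 = trans (*-identityʳ _) (cong suc (*-zeroʳ q))

  level? : ∀ k → Decidable (λ x → rk x ≡ k)
  level? k x = rk x ≟ k

  level-size : ∀ k → k < n → # (level? k) ≡ gauss q n k
  level-size k k<n = gauss-unique q n k _ (begin
    # (level? k) * (qfact q k * qfact q (n ∸ k))
      ≡⟨ cong₂ (λ g d → g * (qfact q k * qfact q (d ∸ k)))
           (#-cong (level? k) (within? k top) (λ x e → e , ≼-top x) (λ _ → proj₁)) (sym rk-top) ⟩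
    # (within? k top) * (qfact q k * qfact q (rk top ∸ k))
      ≡⟨ within-count top (λ j _ → down-degree j) k (subst (k <_) (sym rk-top) k<n) ⟩
    qfact q (rk top)
      ≡⟨ cong (qfact q) rk-top ⟩
    qfact q n ∎)
    where open ≡-Reasoning

  rankedPoset : RankedPoset q n s
  rankedPoset = record
    { _≼_ = _≼_ ; _≼?_ = _≼?_ ; rk = rk ; ≼-trans = ≼-trans ; rk-mono = rk-mono
    ; rk-eq = rk-eq ; ≼-refl = ≼-refl
    ; rk≤n = λ x → subst (rk x ≤_) rk-top (rk-mono (≼-top x))
    ; up-degree = λ {k} x e k<n → trans
        (#-cong (λ y → (rk y ≟ suc k) ×-dec (x ≼? y)) (λ y → within? (suc k) top y ×-dec (x ≼? y))
          (λ y (ey , x≼y) → (ey , ≼-top y) , x≼y) (λ y ((ey , _) , x≼y) → ey , x≼y))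
        (trans (interval-degree x top e (≼-top x) (subst (k <_) (sym rk-top) k<n))
               (cong (λ d → qint q (d ∸ k)) rk-top))
    ; down-degree = λ {k} → down-degree k
    }

-- The lattice of subspaces

does-true : {A : Set} (d : Dec A) → does d ≡ true → A
does-true (yes a) _ = a

^-cancel-≤ : ∀ q {a b} → 2 ≤ q → q ^ a ≤ q ^ b → a ≤ b
^-cancel-≤ q 2≤q le = ≮⇒≥ (λ b<a → <⇒≱ (^-monoʳ-< q 2≤q b<a) le)

^-cancel-≡ : ∀ q {a b} → 2 ≤ q → q ^ a ≡ q ^ b → a ≡ b
^-cancel-≡ q 2≤q e = ≤-antisym (^-cancel-≤ q 2≤q (≤-reflexive e)) (^-cancel-≤ q 2≤q (≤-reflexive (sym e)))

^-qint : ∀ r j → suc r ^ j ≡ 1 + r * qint (suc r) j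
^-qint r zero    = cong suc (sym (*-zeroʳ r))
^-qint r (suc j) = trans (cong (suc r *_) (^-qint r j))
  (solve 2 (λ r x → (con 1 :+ r) :* (con 1 :+ r :* x) := con 1 :+ r :* (con 1 :+ (con 1 :+ r) :* x)) refl r (qint (suc r) j))

-- D is the number of vectors of z outside x, and c classes of size q^(k+1) - q^k = (q-1) q^k
-- partition them. The geometric sum gives D = [d-k] (q-1) q^k, and the class size cancels.
interval-arith : ∀ q {k d D c} → 2 ≤ q → k ≤ d → q ^ d ≡ q ^ k + D →
  D * 1 ≡ c * (q ^ suc k ∸ q ^ k) → c ≡ qint q (d ∸ k)
interval-arith (suc (suc r)) {k} {d} {D} {c} (s≤s (s≤s _)) k≤d eD eC = *-cancelʳ-≡ _ _ (suc r * Q) {{nz}} (begin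
  c * (suc r * Q)             ≡⟨ cong (c *_) (sym (m+n∸m≡n Q (suc r * Q))) ⟩
  c * (Q + suc r * Q ∸ Q)     ≡⟨ sym eC ⟩
  D * 1                       ≡⟨ *-identityʳ D ⟩
  D                           ≡⟨ +-cancelˡ-≡ Q _ _ (begin
      Q + D                          ≡⟨ sym eD ⟩
      suc (suc r) ^ d                ≡⟨ cong (suc (suc r) ^_) (sym (m+[n∸m]≡n k≤d)) ⟩
      suc (suc r) ^ (k + (d ∸ k))    ≡⟨ ^-distribˡ-+-* (suc (suc r)) k (d ∸ k) ⟩
      Q * suc (suc r) ^ (d ∸ k)      ≡⟨ cong (Q *_) (^-qint (suc r) (d ∸ k)) ⟩
      Q * (1 + suc r * X)            ≡⟨ solve 3 (λ Q ρ X → Q :* (con 1 :+ ρ :* X) := Q :+ X :* (ρ :* Q)) refl Q (suc r) X ⟩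
      Q + X * (suc r * Q)            ∎) ⟩
  X * (suc r * Q)             ∎)
  where
  open ≡-Reasoning
  Q X : ℕ
  Q = suc (suc r) ^ k
  X = qint (suc (suc r)) (d ∸ k)
  nz : NonZero (suc r * Q)
  nz = m*n≢0 (suc r) Q {{_}} {{m^n≢0 (suc (suc r)) k}}

funToFin-cong : ∀ {m n} {f g : Fin m → Fin n} → (∀ i → f i ≡ g i) → funToFin f ≡ funToFin g
funToFin-cong {zero}  e = refl
funToFin-cong {suc m} e = cong₂ combine (e zero) (funToFin-cong (e ∘ suc))

-- Scalar multiplication coordinate by coordinate

module Coordinates {q : ℕ} (F : FiniteField q) where
  open FiniteField F
  module R = IsCommutativeRing isCommutativeRing

  field-ring : CommutativeRing 0ℓ 0ℓ
  field-ring = record { isCommutativeRing = isCommutativeRing }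

  open RingProperties (CommutativeRing.ring field-ring) public using (-1*x≈-x)

  ·-distribˡ : ∀ {k} c (x y : Vec (Fin q) k) →
    Vec.map (c *ᶠ_) (Vec.zipWith _+ᶠ_ x y) ≡ Vec.zipWith _+ᶠ_ (Vec.map (c *ᶠ_) x) (Vec.map (c *ᶠ_) y)
  ·-distribˡ c []      []      = refl
  ·-distribˡ c (a ∷ x) (b ∷ y) = cong₂ _∷_ (R.distribˡ c a b) (·-distribˡ c x y)

  ·-distribʳ : ∀ {k} a b (x : Vec (Fin q) k) →
    Vec.map ((a +ᶠ b) *ᶠ_) x ≡ Vec.zipWith _+ᶠ_ (Vec.map (a *ᶠ_) x) (Vec.map (b *ᶠ_) x)
  ·-distribʳ a b []      = refl
  ·-distribʳ a b (c ∷ x) = cong₂ _∷_ (R.distribʳ c a b) (·-distribʳ a b x)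

  ·-assoc : ∀ {k} a b (x : Vec (Fin q) k) →
    Vec.map ((a *ᶠ b) *ᶠ_) x ≡ Vec.map (a *ᶠ_) (Vec.map (b *ᶠ_) x)
  ·-assoc a b []      = refl
  ·-assoc a b (c ∷ x) = cong₂ _∷_ (R.*-assoc a b c) (·-assoc a b x)

  ·-identity : ∀ {k} (x : Vec (Fin q) k) → Vec.map (1ᶠ *ᶠ_) x ≡ x
  ·-identity []      = refl
  ·-identity (c ∷ x) = cong₂ _∷_ (R.*-identityˡ c) (·-identity x)

  ·-zeroˡ : ∀ {k} (x : Vec (Fin q) k) → Vec.map (0ᶠ *ᶠ_) x ≡ Vec.replicate k 0ᶠ
  ·-zeroˡ []      = refl
  ·-zeroˡ (c ∷ x) = cong₂ _∷_ (R.zeroˡ c) (·-zeroˡ x)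

  ·-zeroʳ : ∀ {k} c → Vec.map (c *ᶠ_) (Vec.replicate k 0ᶠ) ≡ Vec.replicate k 0ᶠ
  ·-zeroʳ {zero}  c = refl
  ·-zeroʳ {suc k} c = cong₂ _∷_ (R.zeroʳ c) (·-zeroʳ c)

  ·-neg : ∀ {k} (x : Vec (Fin q) k) → Vec.map ((-ᶠ 1ᶠ) *ᶠ_) x ≡ Vec.map -ᶠ_ x
  ·-neg []      = refl
  ·-neg (c ∷ x) = cong₂ _∷_ (-1*x≈-x c) (·-neg x)

  2≤order : 2 ≤ q
  2≤order = two q 0ᶠ 1ᶠ 0≢1
    where
    two : ∀ q (x y : Fin q) → x ≢ y → 2 ≤ q
    two (suc zero)    zero zero x≢y = contradiction refl x≢y
    two (suc (suc _)) _    _    _   = s≤s (s≤s z≤n)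

-- Extending subspaces and their bases by a vector

module Subspaces {q : ℕ} (F : FiniteField q) (n : ℕ) where
  open FiniteField F using (_+ᶠ_; _*ᶠ_; -ᶠ_; 0ᶠ; 1ᶠ; inverse)
  open VectorSpace F n
  open Coordinates F using (module R; ·-distribˡ; ·-distribʳ; ·-assoc; ·-identity; ·-zeroˡ; ·-zeroʳ; ·-neg; 2≤order)

  vectors : AbelianGroup 0ℓ 0ℓ
  vectors = record
    { Carrier = V ; _≈_ = _≡_ ; _∙_ = _+ᵛ_ ; ε = 0ᵛ ; _⁻¹ = Vec.map -ᶠ_
    ; isAbelianGroup = record
      { isGroup = record
        { isMonoid = record
          { isSemigroup = record
            { isMagma = record { isEquivalence = isEquivalence ; ∙-cong = cong₂ _+ᵛ_ }
            ; assoc = Vec.zipWith-assoc R.+-assoc }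
          ; identity = Vec.zipWith-identityˡ R.+-identityˡ , Vec.zipWith-identityʳ R.+-identityʳ }
        ; inverse = Vec.zipWith-inverseˡ R.-‿inverseˡ , Vec.zipWith-inverseʳ R.-‿inverseʳ
        ; ⁻¹-cong = cong (Vec.map -ᶠ_) }
      ; comm = Vec.zipWith-comm R.+-comm } }

  open AbelianGroup vectors using (assoc; comm; identityˡ; identityʳ; inverseʳ)
  open AbelianGroupProperties vectors using (inverseˡ-unique)
  open CommutativeSemigroupProperties (AbelianGroup.commutativeSemigroup vectors) using (interchange)

  infix 4 _∈ˢ_ _∈ˢ?_
  _∈ˢ_ : V → Subspace → Set
  x ∈ˢ W = mem W x ≡ true

  _∈ˢ?_ : ∀ x W → Dec (x ∈ˢ W)
  x ∈ˢ? W = mem W x Bool.≟ true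

  cancel-multiple : ∀ y c x → (y +ᵛ (c ·ᵛ x)) +ᵛ ((-ᶠ c) ·ᵛ x) ≡ y
  cancel-multiple y c x = trans (assoc y _ _) (trans (cong (y +ᵛ_)
    (trans (sym (·-distribʳ c (-ᶠ c) x)) (trans (cong (_·ᵛ x) (R.-‿inverseʳ c)) (·-zeroˡ x))))
    (identityʳ y))

  zeroˢ : Subspace
  zeroˢ .mem x = does (Vec.≡-dec _≟ᶠ_ x 0ᵛ)
  zeroˢ .mem-0 = dec-true (Vec.≡-dec _≟ᶠ_ 0ᵛ 0ᵛ) refl
  zeroˢ .mem-+ x y mx my with refl ← does-true (Vec.≡-dec _≟ᶠ_ x 0ᵛ) mx | refl ← does-true (Vec.≡-dec _≟ᶠ_ y 0ᵛ) my =
    dec-true (Vec.≡-dec _≟ᶠ_ _ 0ᵛ) (identityˡ 0ᵛ)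
  zeroˢ .mem-· c x mx with refl ← does-true (Vec.≡-dec _≟ᶠ_ x 0ᵛ) mx =
    dec-true (Vec.≡-dec _≟ᶠ_ _ 0ᵛ) (·-zeroʳ c)

  zeroˢ-min : ∀ W → zeroˢ ⊆ˢ W
  zeroˢ-min W x mx with refl ← does-true (Vec.≡-dec _≟ᶠ_ x 0ᵛ) mx = mem-0 W

  fullˢ : Subspace
  fullˢ .mem _ = true
  fullˢ .mem-0 = refl
  fullˢ .mem-+ _ _ _ _ = refl
  fullˢ .mem-· _ _ _ = refl

  zeroˢ-dim : HasDim zeroˢ 0
  zeroˢ-dim = (λ ()) , (λ _ _ ()) , (λ ()) , λ x mx → (λ ()) , does-true (Vec.≡-dec _≟ᶠ_ x 0ᵛ) mx

  -- y lies in the span of W and x iff some y + c x lies in W.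
  inExt? : ∀ W x y → Dec (∃ λ c → y +ᵛ (c ·ᵛ x) ∈ˢ W)
  inExt? W x y = any? (λ c → (y +ᵛ (c ·ᵛ x)) ∈ˢ? W)

  ext : Subspace → V → Subspace
  ext W x .mem y = does (inExt? W x y)
  ext W x .mem-0 = dec-true (inExt? W x 0ᵛ) (0ᶠ , subst (_∈ˢ W)
    (sym (trans (identityˡ _) (·-zeroˡ x))) (mem-0 W))
  ext W x .mem-+ y z my mz with does-true (inExt? W x y) my | does-true (inExt? W x z) mz
  ... | a , ya | b , zb = dec-true (inExt? W x (y +ᵛ z)) (a +ᶠ b , subst (_∈ˢ W)
    (trans (interchange y _ z _) (cong ((y +ᵛ z) +ᵛ_) (sym (·-distribʳ a b x))))
    (mem-+ W _ _ ya zb))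
  ext W x .mem-· c y my with does-true (inExt? W x y) my
  ... | a , ya = dec-true (inExt? W x (c ·ᵛ y)) (c *ᶠ a , subst (_∈ˢ W)
    (trans (·-distribˡ c y _) (cong ((c ·ᵛ y) +ᵛ_) (sym (·-assoc c a x))))
    (mem-· W c _ ya))

  ⊆-ext : ∀ W x → W ⊆ˢ ext W x
  ⊆-ext W x y my = dec-true (inExt? W x y) (0ᶠ , subst (_∈ˢ W)
    (sym (trans (cong (y +ᵛ_) (·-zeroˡ x)) (identityʳ y))) my)

  ∈-ext : ∀ W x → x ∈ˢ ext W x
  ∈-ext W x = dec-true (inExt? W x x) (-ᶠ 1ᶠ , subst (_∈ˢ W)
    (sym (trans (cong (x +ᵛ_) (·-neg x)) (inverseʳ x))) (mem-0 W))

  ext-min : ∀ W x U → W ⊆ˢ U → x ∈ˢ U → ext W x ⊆ˢ U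
  ext-min W x U W⊆U x∈U y my with does-true (inExt? W x y) my
  ... | c , yc = subst (_∈ˢ U) (cancel-multiple y c x)
    (mem-+ U _ _ (W⊆U _ yc) (mem-· U (-ᶠ c) x x∈U))

  lincomb-cong : ∀ {k} {c d : Fin k → Fin q} (b : Fin k → V) → (∀ i → c i ≡ d i) → lincomb c b ≡ lincomb d b
  lincomb-cong {zero}  b e = refl
  lincomb-cong {suc k} b e = cong₂ _+ᵛ_ (cong (_·ᵛ b zero) (e zero)) (lincomb-cong (b ∘ suc) (e ∘ suc))

  lincomb-∈ : ∀ {k} W (c : Fin k → Fin q) (b : Fin k → V) → (∀ i → b i ∈ˢ W) → lincomb c b ∈ˢ W
  lincomb-∈ {zero}  W c b mb = mem-0 W
  lincomb-∈ {suc k} W c b mb = mem-+ W _ _ (mem-· W _ _ (mb zero)) (lincomb-∈ W (c ∘ suc) (b ∘ suc) (mb ∘ suc))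

  lincomb-+ : ∀ {k} (c d : Fin k → Fin q) (b : Fin k → V) →
    lincomb (λ i → c i +ᶠ d i) b ≡ lincomb c b +ᵛ lincomb d b
  lincomb-+ {zero}  c d b = sym (identityˡ 0ᵛ)
  lincomb-+ {suc k} c d b = trans
    (cong₂ _+ᵛ_ (·-distribʳ (c zero) (d zero) (b zero)) (lincomb-+ (c ∘ suc) (d ∘ suc) (b ∘ suc)))
    (interchange _ _ _ _)

  -- Independence is applied to the differences of the coefficients.
  lincomb-injective : ∀ {k} {b : Fin k → V} → LinIndep b → ∀ c d → lincomb c b ≡ lincomb d b → ∀ i → c i ≡ d i
  lincomb-injective {b = b} ind c d e i = begin
    c i                            ≡⟨ sym (R.+-identityʳ _) ⟩
    c i +ᶠ 0ᶠ                      ≡⟨ cong (c i +ᶠ_) (sym (R.-‿inverseˡ (d i))) ⟩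
    c i +ᶠ ((-ᶠ d i) +ᶠ d i)       ≡⟨ sym (R.+-assoc _ _ _) ⟩
    (c i +ᶠ (-ᶠ d i)) +ᶠ d i       ≡⟨ cong (_+ᶠ d i) (ind (λ i → c i +ᶠ (-ᶠ d i)) difference i) ⟩
    0ᶠ +ᶠ d i                      ≡⟨ R.+-identityˡ _ ⟩
    d i                            ∎
    where
    open ≡-Reasoning
    lincomb-0 : ∀ {k} (b : Fin k → V) → lincomb (λ _ → 0ᶠ) b ≡ 0ᵛ
    lincomb-0 {zero}  b = refl
    lincomb-0 {suc k} b = trans (cong₂ _+ᵛ_ (·-zeroˡ (b zero)) (lincomb-0 (b ∘ suc))) (identityˡ 0ᵛ)
    difference : lincomb (λ i → c i +ᶠ (-ᶠ d i)) b ≡ 0ᵛ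
    difference = begin
      lincomb (λ i → c i +ᶠ (-ᶠ d i)) b           ≡⟨ lincomb-+ c (λ i → -ᶠ d i) b ⟩
      lincomb c b +ᵛ lincomb (λ i → -ᶠ d i) b     ≡⟨ cong (_+ᵛ lincomb (λ i → -ᶠ d i) b) e ⟩
      lincomb d b +ᵛ lincomb (λ i → -ᶠ d i) b     ≡⟨ sym (lincomb-+ d (λ i → -ᶠ d i) b) ⟩
      lincomb (λ i → d i +ᶠ (-ᶠ d i)) b           ≡⟨ lincomb-cong b (λ i → R.-‿inverseʳ (d i)) ⟩
      lincomb (λ _ → 0ᶠ) b                        ≡⟨ lincomb-0 b ⟩
      0ᵛ                                          ∎

  -- The vector x is put in front of the basis of W. In a vanishing combination a nonzero
  -- coefficient of x could be inverted, placing x in W; hence it is zero and the old independence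
  -- applies. For spanning, y + a x ∈ W gives y the coefficient -a at x.
  ext-dim : ∀ {k} W x → HasDim W k → ¬ x ∈ˢ W → HasDim (ext W x) (suc k)
  ext-dim {k} W x (b , ind , mb , spans) x∉W = b′ , ind′ , mb′ , spans′
    where
    open ≡-Reasoning
    b′ : Fin (suc k) → V
    b′ zero    = x
    b′ (suc i) = b i
    mb′ : ∀ i → b′ i ∈ˢ ext W x
    mb′ zero    = ∈-ext W x
    mb′ (suc i) = ⊆-ext W x _ (mb i)
    x∈W : ∀ c d L → c *ᶠ d ≡ 1ᶠ → L ∈ˢ W → (c ·ᵛ x) +ᵛ L ≡ 0ᵛ → x ∈ˢ W
    x∈W c d L cd L∈W e = subst (_∈ˢ W) (begin
      d ·ᵛ ((-ᶠ 1ᶠ) ·ᵛ L)  ≡⟨ cong (d ·ᵛ_) (trans (·-neg L) (sym (inverseˡ-unique _ _ e))) ⟩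
      d ·ᵛ (c ·ᵛ x)        ≡⟨ sym (·-assoc d c x) ⟩
      (d *ᶠ c) ·ᵛ x        ≡⟨ cong (_·ᵛ x) (trans (R.*-comm d c) cd) ⟩
      1ᶠ ·ᵛ x              ≡⟨ ·-identity x ⟩
      x                    ∎) (mem-· W d _ (mem-· W (-ᶠ 1ᶠ) L L∈W))
    ind′ : LinIndep b′
    ind′ c e with c zero ≟ᶠ 0ᶠ
    ... | no c≢0 with inverse (c zero) c≢0
    ...   | d , cd = contradiction (x∈W (c zero) d _ cd (lincomb-∈ W (c ∘ suc) b mb) e) x∉W
    ind′ c e | yes c≡0 = λ
      { zero    → c≡0
      ; (suc i) → ind (c ∘ suc) (begin
          lincomb (c ∘ suc) b                      ≡⟨ sym (identityˡ _) ⟩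
          0ᵛ +ᵛ lincomb (c ∘ suc) b                ≡⟨ cong (_+ᵛ lincomb (c ∘ suc) b) (sym (trans (cong (_·ᵛ x) c≡0) (·-zeroˡ x))) ⟩
          (c zero ·ᵛ x) +ᵛ lincomb (c ∘ suc) b     ≡⟨ e ⟩
          0ᵛ                                       ∎) i }
    spans′ : ∀ y → y ∈ˢ ext W x → ∃ λ c → y ≡ lincomb c b′
    spans′ y my with does-true (inExt? W x y) my
    ... | a , ya with spans _ ya
    ...   | c , e = c′ , (begin
      y                                              ≡⟨ sym (cancel-multiple y a x) ⟩
      (y +ᵛ (a ·ᵛ x)) +ᵛ ((-ᶠ a) ·ᵛ x)               ≡⟨ comm _ _ ⟩
      ((-ᶠ a) ·ᵛ x) +ᵛ (y +ᵛ (a ·ᵛ x))               ≡⟨ cong (((-ᶠ a) ·ᵛ x) +ᵛ_) e ⟩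
      ((-ᶠ a) ·ᵛ x) +ᵛ lincomb c b                   ∎)
      where
      c′ : Fin (suc k) → Fin q
      c′ zero    = -ᶠ a
      c′ (suc i) = c i

  HasDim-≐ : ∀ W U {k} → W ≐ U → HasDim W k → HasDim U k
  HasDim-≐ W U (W⊆U , U⊆W) (b , ind , mb , spans) =
    b , ind , (λ i → W⊆U _ (mb i)) , λ x mx → spans x (U⊆W x mx)

  -- Counting vectors and comparing dimensions

  encode : V → Fin (q ^ n)
  encode x = funToFin (Vec.lookup x)

  decode : Fin (q ^ n) → V
  decode i = Vec.tabulate (finToFun i)

  decode-encode : ∀ x → decode (encode x) ≡ x
  decode-encode x = trans (Vec.tabulate-cong (finToFun-funToFin (Vec.lookup x))) (Vec.tabulate∘lookup x)

  encode-decode : ∀ i → encode (decode i) ≡ i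
  encode-decode i = trans (funToFin-cong {n} (Vec.lookup∘tabulate (finToFun {q} {n} i))) (funToFin-finToFin {n} {q} i)

  mem? : ∀ W → Decidable (λ i → decode i ∈ˢ W)
  mem? W i = decode i ∈ˢ? W

  -- Reduces a statement about all vectors to finitely many codes, which makes inclusion of
  -- subspaces decidable.
  via-decode : ∀ {P : V → Set} → (∀ i → P (decode i)) → ∀ x → P x
  via-decode {P} p x = subst P (decode-encode x) (p (encode x))

  card : Subspace → ℕ
  card W = # (mem? W)

  -- Coefficient families, numbered by `Fin (q ^ k)`, are mapped to their linear combinations:
  -- spanning makes this map onto W, independence makes it injective.
  card-dim : ∀ W {k} → HasDim W k → card W ≡ q ^ k
  card-dim W {k} (b , ind , mb , spans) = ≤-antisym
    (#-surjection (mem? W) f (λ i mi →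
      let c , e = spans (decode i) mi
      in funToFin c , trans (cong encode (trans (lincomb-cong b (finToFun-funToFin c)) (sym e))) (encode-decode i)))
    (#-injection (mem? W) f f-injective
      (λ j → subst (_∈ˢ W) (sym (decode-encode _)) (lincomb-∈ W (finToFun j) b mb)))
    where
    f : Fin (q ^ k) → Fin (q ^ n)
    f j = encode (lincomb (finToFun {q} {k} j) b)
    f-injective : Injective _≡_ _≡_ f
    f-injective {i} {j} e = begin
      i                              ≡⟨ sym (funToFin-finToFin {k} {q} i) ⟩
      funToFin (finToFun {q} {k} i)  ≡⟨ funToFin-cong {k} (lincomb-injective ind (finToFun i) (finToFun j)
                                          (trans (sym (decode-encode _)) (trans (cong decode e) (decode-encode _)))) ⟩
      funToFin (finToFun {q} {k} j)  ≡⟨ funToFin-finToFin {k} {q} j ⟩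
      j                              ∎
      where open ≡-Reasoning

  -- Both dimensions are the exponent of the same power of q, and q ≥ 2.
  dim-unique : ∀ W {k j} → HasDim W k → HasDim W j → k ≡ j
  dim-unique W hk hj = ^-cancel-≡ q 2≤order (trans (sym (card-dim W hk)) (card-dim W hj))

  card-full : card fullˢ ≡ q ^ n
  card-full = trans (#-cong (mem? fullˢ) (λ _ → yes tt) (λ _ _ → tt) (λ _ _ → refl)) (#-all (q ^ n))

  ⊆-≐ : ∀ W U {k} → HasDim W k → HasDim U k → W ⊆ˢ U → W ≐ U
  ⊆-≐ W U hW hU W⊆U = W⊆U , via-decode (#-full (mem? W) (mem? U) (λ i → W⊆U (decode i))
    (≤-reflexive (trans (card-dim U hU) (sym (card-dim W hW)))))

  ⊆-dim : ∀ W U {k d} → HasDim W k → HasDim U d → W ⊆ˢ U → k ≤ d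
  ⊆-dim W U hW hU W⊆U = ^-cancel-≤ q 2≤order (subst₂ _≤_ (card-dim W hW) (card-dim U hU)
    (#-mono (mem? W) (mem? U) (λ i → W⊆U (decode i))))

  -- Enumeration of all subspaces

  _⊆ˢ?_ : ∀ W U → Dec (W ⊆ˢ U)
  W ⊆ˢ? U = map′ via-decode (λ W⊆U → W⊆U ∘ decode) (all? (λ i → mem? W i →-dec mem? U i))

  _≐?_ : ∀ W U → Dec (W ≐ U)
  W ≐? U = (W ⊆ˢ? U) ×-dec (U ⊆ˢ? W)

  ≐-sym : ∀ W U → W ≐ U → U ≐ W
  ≐-sym W U (a , b) = b , a

  ≐-trans : ∀ W U X → W ≐ U → U ≐ X → W ≐ X
  ≐-trans W U X (a , b) (c , d) = (λ x → c x ∘ a x) , (λ x → b x ∘ d x)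

  ≐-decSetoid : DecSetoid 0ℓ 0ℓ
  ≐-decSetoid = record
    { Carrier = Subspace ; _≈_ = _≐_
    ; isDecEquivalence = record
      { isEquivalence = record { refl = (λ _ m → m) , (λ _ m → m) ; sym = λ {W} {U} → ≐-sym W U ; trans = λ {W} {U} {X} → ≐-trans W U X }
      ; _≟_ = _≐?_ } }

  -- Every subspace is the span of its own vectors, so the spans of all
  -- sublists of a list of all vectors exhaust the subspaces.
  spans : List V → List Subspace
  spans []       = zeroˢ ∷ []
  spans (x ∷ xs) = spans xs ++ List.map (λ W → ext W x) (spans xs)

  -- Selects the sublist whose span witnesses that W occurs among `spans`.
  trace : Subspace → List V → Subspace
  trace W [] = zeroˢ
  trace W (x ∷ xs) with x ∈ˢ? W
  ... | yes _ = ext (trace W xs) x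
  ... | no  _ = trace W xs

  trace∈spans : ∀ W xs → trace W xs ∈ spans xs
  trace∈spans W [] = here refl
  trace∈spans W (x ∷ xs) with x ∈ˢ? W
  ... | yes _ = ∈-++⁺ʳ (spans xs) (∈-map⁺ (λ W → ext W x) (trace∈spans W xs))
  ... | no  _ = ∈-++⁺ˡ (trace∈spans W xs)

  trace-⊆ : ∀ W xs → trace W xs ⊆ˢ W
  trace-⊆ W [] = zeroˢ-min W
  trace-⊆ W (x ∷ xs) with x ∈ˢ? W
  ... | yes x∈W = ext-min (trace W xs) x W (trace-⊆ W xs) x∈W
  ... | no  _   = trace-⊆ W xs

  trace-∋ : ∀ W xs {x} → x ∈ xs → x ∈ˢ W → x ∈ˢ trace W xs
  trace-∋ W (x ∷ xs) i x∈W with x ∈ˢ? W | i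
  ... | yes _   | here refl = ∈-ext (trace W xs) x
  ... | yes _   | there j   = ⊆-ext (trace W xs) x _ (trace-∋ W xs j x∈W)
  ... | no  x∉W | here refl = contradiction x∈W x∉W
  ... | no  _   | there j   = trace-∋ W xs j x∈W

  -- A selected vector raises the dimension if it is outside the span so far and changes nothing
  -- otherwise. Applied to all vectors, this gives every subspace a basis.
  trace-dim : ∀ W xs → ∃ (HasDim (trace W xs))
  trace-dim W [] = 0 , zeroˢ-dim
  trace-dim W (x ∷ xs) with x ∈ˢ? W
  ... | no  _ = trace-dim W xs
  ... | yes _ with x ∈ˢ? trace W xs | trace-dim W xs
  ...   | no x∉T  | k , h = suc k , ext-dim (trace W xs) x h x∉T
  ...   | yes x∈T | k , h = k , HasDim-≐ T (ext T x) (⊆-ext T x , ext-min T x T (λ _ m → m) x∈T) h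
    where
    T : Subspace
    T = trace W xs

  allVectors : List V
  allVectors = List.tabulate decode

  trace-≐ : ∀ W → trace W allVectors ≐ W
  trace-≐ W = trace-⊆ W allVectors , λ x → trace-∋ W allVectors
    (subst (_∈ allVectors) (decode-encode x) (∈-tabulate⁺ {f = decode} (encode x)))

  dimension : ∀ W → ∃ (HasDim W)
  dimension W = map₂ (HasDim-≐ (trace W allVectors) W (trace-≐ W)) (trace-dim W allVectors)

  dim : Subspace → ℕ
  dim W = proj₁ (dimension W)

  -- Different sublists can have the same span; once repetitions up to `≐` are removed, equality of
  -- indices is equality of subspaces.
  subspaces : List Subspace
  subspaces = deduplicate _≐?_ (spans allVectors)

  S : Fin (length subspaces) → Subspace
  S = List.lookup subspaces

  AllPairs-distinct : ∀ {𝓕} → AllPairs (λ W U → ¬ (W ≐ U)) 𝓕 → Distinct 𝓕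
  AllPairs-distinct (ps ∷ _) zero    zero    i≢j _ = i≢j refl
  AllPairs-distinct (ps ∷ _) zero    (suc j) _   e = All.lookup ps (∈-lookup j) e
  AllPairs-distinct {W ∷ 𝓕} (ps ∷ _) (suc i) zero _ e =
    All.lookup ps (∈-lookup i) (≐-sym (List.lookup 𝓕 i) W e)
  AllPairs-distinct (_ ∷ ap) (suc i) (suc j) i≢j e = AllPairs-distinct ap i j (i≢j ∘ cong suc) e

  subspaces-unique : AllPairs (λ W U → ¬ (W ≐ U)) subspaces
  subspaces-unique = Unique.deduplicate-! ≐-decSetoid (spans allVectors)

  S-injective : ∀ i j → S i ≐ S j → i ≡ j
  S-injective i j e with i ≟ᶠ j
  ... | yes i≡j = i≡j
  ... | no  i≢j = contradiction e (AllPairs-distinct subspaces-unique i j i≢j)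

  occurs : ∀ W → Any (_≐ W) subspaces
  occurs W = Any.deduplicate⁺ _≐?_ (λ {X} {U} → ≐-trans U X W)
    (lose (trace∈spans W allVectors) (trace-≐ W))

  index : Subspace → Fin (length subspaces)
  index W = Any.index (occurs W)

  S-index : ∀ W → S (index W) ≐ W
  S-index W = Any.lookup-index (occurs W)

  -- The subspace lattice as a graded poset

  _≼_ : Fin (length subspaces) → Fin (length subspaces) → Set
  i ≼ j = S i ⊆ˢ S j

  rk : Fin (length subspaces) → ℕ
  rk i = dim (S i)

  rk-dim : ∀ i → HasDim (S i) (rk i)
  rk-dim i = proj₂ (dimension (S i))

  rk-index : ∀ W {k} → HasDim W k → rk (index W) ≡ k
  rk-index W h = dim-unique (S (index W)) (rk-dim (index W)) (HasDim-≐ W (S (index W)) (≐-sym (S (index W)) W (S-index W)) h)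

  ≼-rk-eq : ∀ {i j} → i ≼ j → rk i ≡ rk j → i ≡ j
  ≼-rk-eq {i} {j} i≼j e = S-injective i j (⊆-≐ (S i) (S j) (rk-dim i) (subst (HasDim (S j)) (sym e) (rk-dim j)) i≼j)

  -- A vector of z outside x lies in exactly one subspace between x and z of
  -- dimension one more than x, and each such subspace has q^(k+1) - q^k of them.
  interval-degree : ∀ {k} x z → rk x ≡ k → x ≼ z → k < rk z →
    # (λ y → ((rk y ≟ suc k) ×-dec (S y ⊆ˢ? S z)) ×-dec (S x ⊆ˢ? S y)) ≡ qint q (rk z ∸ k)
  interval-degree {k} x z refl x≼z k<d = interval-arith q 2≤order (<⇒≤ k<d) (difference-size x≼z) count
    where
    between? : Decidable (λ y → (rk y ≡ suc k × y ≼ z) × x ≼ y)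
    between? y = ((rk y ≟ suc k) ×-dec (S y ⊆ˢ? S z)) ×-dec (S x ⊆ˢ? S y)
    difference? : ∀ y → Decidable (λ v → decode v ∈ˢ S y × ¬ (decode v ∈ˢ S x))
    difference? y v = mem? (S y) v ×-dec ¬? (mem? (S x) v)
    difference-size : ∀ {y} → x ≼ y → q ^ rk y ≡ q ^ k + # (difference? y)
    difference-size {y} x≼y = trans (sym (card-dim (S y) (rk-dim y))) (trans (#-split (mem? (S y)) (mem? (S x)))
      (cong (_+ # (difference? y)) (trans
        (#-cong (λ v → mem? (S y) v ×-dec mem? (S x) v) (mem? (S x)) (λ _ → proj₂) (λ v m → x≼y _ m , m))
        (card-dim (S x) (rk-dim x)))))
    through? : ∀ v y → Dec (decode v ∈ˢ S y)
    through? v y = mem? (S y) v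
    one-through : ∀ v → decode v ∈ˢ S z × ¬ (decode v ∈ˢ S x) →
      # (λ y → between? y ×-dec through? v y) ≡ 1
    one-through v (v∈z , v∉x) = ≤-antisym
      (#-unique (λ y → between? y ×-dec through? v y) (λ y y′ b b′ → trans (sym (is-e y b)) (is-e y′ b′)))
      (#-some (λ y → between? y ×-dec through? v y)
        (e , ((rk-e , λ w → ext-min (S x) (decode v) (S z) x≼z v∈z w ∘ e⊆ w) , λ w → ⊆e w ∘ ⊆-ext (S x) (decode v) w) , ⊆e _ (∈-ext (S x) (decode v))))
      where
      U : Subspace
      U = ext (S x) (decode v)
      e : Fin (length subspaces)
      e = index U
      e⊆ : S e ⊆ˢ U
      e⊆ = proj₁ (S-index U)
      ⊆e : U ⊆ˢ S e
      ⊆e = proj₂ (S-index U)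
      rk-e : rk e ≡ suc k
      rk-e = rk-index U (ext-dim (S x) (decode v) (rk-dim x) v∉x)
      -- Any such y contains x and the vector, hence their span; the ranks agree, so y is that span.
      is-e : ∀ y → ((rk y ≡ suc k × y ≼ z) × x ≼ y) × decode v ∈ˢ S y → e ≡ y
      is-e y (((ry , _) , x≼y) , v∈y) =
        ≼-rk-eq (λ w → ext-min (S x) (decode v) (S y) x≼y v∈y w ∘ e⊆ w) (trans rk-e (sym ry))
    count : # (difference? z) * 1 ≡ # between? * (q ^ suc k ∸ q ^ k)
    count = double-count-≡ (difference? z) between? through? one-through
      (λ y ((ry , y≼z) , x≼y) → trans
        (#-cong (λ v → difference? z v ×-dec through? v y) (difference? y)
          (λ v ((_ , v∉x) , v∈y) → v∈y , v∉x) (λ v (v∈y , v∉x) → (y≼z _ v∈y , v∉x) , v∈y))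
        (sym (trans (cong (_∸ q ^ k) (trans (cong (q ^_) (sym ry)) (difference-size x≼y)))
                    (m+n∸m≡n (q ^ k) _))))

  gradedPoset : GradedPoset q n (length subspaces)
  gradedPoset = record
    { _≼_ = _≼_ ; _≼?_ = λ i j → S i ⊆ˢ? S j ; rk = rk
    ; ≼-trans = λ a b x → b x ∘ a x
    ; rk-mono = λ {i} {j} → ⊆-dim (S i) (S j) (rk-dim i) (rk-dim j)
    ; rk-eq = ≼-rk-eq
    ; ≼-refl = λ _ m → m
    ; bot = index zeroˢ ; top = index fullˢ
    ; rk-bot = rk-index zeroˢ zeroˢ-dim
    -- The dimension of the full space is read off from its q^n vectors rather than from a standard
    -- basis.
    ; rk-top = trans (rk-index fullˢ (proj₂ (dimension fullˢ)))
        (^-cancel-≡ q 2≤order (trans (sym (card-dim fullˢ (proj₂ (dimension fullˢ)))) card-full))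
    ; bot-≼ = λ i x → zeroˢ-min (S i) x ∘ proj₁ (S-index zeroˢ) x
    ; ≼-top = λ i x _ → proj₂ (S-index fullˢ) x refl
    ; interval-degree = interval-degree
    }

-- Families of subspaces as sets of lattice elements

module Families {q : ℕ} (F : FiniteField q) (n : ℕ) where
  open VectorSpace F n
  open Subspaces F n
  open Gaussian gradedPoset using (rankedPoset; level?; level-size)

  module Positions (𝓕 : Family) (distinct : Distinct 𝓕) where

    pos : Fin (length 𝓕) → Fin (length subspaces)
    pos i = index (List.lookup 𝓕 i)

    pos-≐ : ∀ i → S (pos i) ≐ List.lookup 𝓕 i
    pos-≐ i = S-index (List.lookup 𝓕 i)

    pos-injective : Injective _≡_ _≡_ pos
    pos-injective {i} {j} e with i ≟ᶠ j
    ... | yes i≡j = i≡j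
    ... | no  i≢j = contradiction
      (≐-trans Wi (S (pos i)) Wj (≐-sym (S (pos i)) Wi (pos-≐ i))
        (subst (λ k → S k ≐ Wj) (sym e) (pos-≐ j)))
      (distinct i j i≢j)
      where
      Wi Wj : Subspace
      Wi = List.lookup 𝓕 i
      Wj = List.lookup 𝓕 j

    Member : Fin (length subspaces) → Set
    Member e = ∃ λ i → pos i ≡ e

    member? : Decidable Member
    member? e = any? (λ i → pos i ≟ᶠ e)

    size : # member? ≡ length 𝓕
    size = ≤-antisym (#-surjection member? pos (λ _ mem → mem))
                     (#-injection member? pos pos-injective (λ i → i , refl))

    pos-mono : ∀ i j → S (pos i) ⊆ˢ S (pos j) → List.lookup 𝓕 i ⊆ˢ List.lookup 𝓕 j
    pos-mono i j le x = proj₁ (pos-≐ j) x ∘ le x ∘ proj₂ (pos-≐ i) x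

    -- Serves forks and brooms alike, with R the inclusion or its reverse. The centre is x and the
    -- leaves are v selected members; injectivity at the centre comes from the condition `x ≢ y`.
    star : {R : Fin (length subspaces) → Fin (length subspaces) → Set} (R? : ∀ x y → Dec (R x y)) →
      ∀ v x → Member x → v ≤ # (λ y → member? y ×-dec (R? x y ×-dec ¬? (x ≟ᶠ y))) →
      Σ (Fin (suc v) → Fin (length 𝓕)) λ θ →
        Injective _≡_ _≡_ θ × (∀ i → R (pos (θ zero)) (pos (θ (suc i))))
    star {R} R? v x (i₀ , refl) v≤ with #-select (λ y → member? y ×-dec (R? x y ×-dec ¬? (x ≟ᶠ y))) v v≤
    ... | f , f-inj , pf = θ , θ-inj , λ i → subst (R x) (sym (pos-θ i)) (proj₁ (proj₂ (pf i)))
      where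
      θ : Fin (suc v) → Fin (length 𝓕)
      θ zero    = i₀
      θ (suc i) = proj₁ (proj₁ (pf i))
      pos-θ : ∀ i → pos (θ (suc i)) ≡ f i
      pos-θ i = proj₂ (proj₁ (pf i))
      θ-inj : Injective _≡_ _≡_ θ
      θ-inj {zero}  {zero}  _ = refl
      θ-inj {zero}  {suc j} e = contradiction (trans (cong pos e) (pos-θ j)) (proj₂ (proj₂ (pf j)))
      θ-inj {suc i} {zero}  e = contradiction (trans (cong pos (sym e)) (pos-θ i)) (proj₂ (proj₂ (pf i)))
      θ-inj {suc i} {suc j} e = cong suc (f-inj (trans (sym (pos-θ i)) (trans (cong pos e) (pos-θ j))))

  module Bound (m : ℕ) (n≡m+m : n ≡ m + m) (1≤m : 1 ≤ m) {u v : ℕ} (u≤q : u ≤ q) (v≤q : v ≤ q) where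

    m<n : m < n
    m<n = subst (m <_) (sym n≡m+m) (m<m+n m 1≤m)

    module _ (𝓕 : Family) (free : BroomForkFree u v 𝓕) where
      open Positions 𝓕 (proj₁ free)
      private module M = Middle rankedPoset m n≡m+m (Coordinates.2≤order F) member?

      -- Since v ≤ q, any q members strictly above x would already include the leaves of a v-fork.
      few-above : ∀ x → Member x → # (M.Up.above? x) < q
      few-above x mx = ≰⇒> λ q≤ →
        let θ , θ-inj , le = star (λ x y → S x ⊆ˢ? S y) v x mx (≤-trans v≤q q≤)
        in proj₂ (proj₂ free) (θ , θ-inj , λ i → pos-mono (θ zero) (θ (suc i)) (le i))

      -- In the dual poset, `above?` refers to members strictly below x, so u ≤ q of them would form
      -- a u-broom.
      few-below : ∀ x → Member x → # (M.Down.above? x) < q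
      few-below x mx = ≰⇒> λ q≤ →
        let θ , θ-inj , le = star (λ x y → S y ⊆ˢ? S x) u x mx (≤-trans u≤q q≤)
        in proj₁ (proj₂ free) (θ , θ-inj , λ i → pos-mono (θ (suc i)) (θ zero) (le i))

      length-bound : length 𝓕 ≤ gauss q n m
      length-bound = subst₂ _≤_ size (level-size m m<n) (M.size≤ few-above few-below)

      full-is-level : length 𝓕 ≡ gauss q n m → IsLevel m 𝓕
      full-is-level full = dims , λ W h →
        let i , e = M.middle⊆F few-above few-below #≡ (index W) (rk-index W h)
        in i , ≐-trans (List.lookup 𝓕 i) (S (pos i)) W (≐-sym (S (pos i)) (List.lookup 𝓕 i) (pos-≐ i))
                 (subst (λ k → S k ≐ W) (sym e) (S-index W))
        where
        #≡ : # member? ≡ # M.middle?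
        #≡ = trans size (trans full (sym (level-size m m<n)))
        dims : ∀ i → HasDim (List.lookup 𝓕 i) m
        dims i = HasDim-≐ (S (pos i)) (List.lookup 𝓕 i) (pos-≐ i)
          (subst (HasDim (S (pos i))) (M.F⊆middle few-above few-below #≡ (pos i) (i , refl)) (rk-dim (pos i)))

  -- The level families attain the bound

  dim? : ∀ k → Decidable (λ W → dim W ≡ k)
  dim? k W = dim W ≟ k

  levelFamily : ℕ → Family
  levelFamily k = filter (dim? k) subspaces

  levelFamily-distinct : ∀ k → Distinct (levelFamily k)
  levelFamily-distinct k = AllPairs-distinct (AllPairs.filter⁺ (dim? k) subspaces-unique)

  levelFamily-isLevel : ∀ k → IsLevel k (levelFamily k)
  levelFamily-isLevel k =
    (λ i → let W = List.lookup (levelFamily k) i in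
      subst (HasDim W) (All.lookup (All.all-filter (dim? k) subspaces) (∈-lookup i)) (proj₂ (dimension W))) ,
    λ W h →
      let W∈ = ∈-filter⁺ (dim? k) {xs = subspaces} (∈-lookup {xs = subspaces} (index W)) (rk-index W h)
      in Any.index W∈ , subst (_≐ W) (Any.lookup-index W∈) (S-index W)

  module _ (𝓕 : Family) (distinct : Distinct 𝓕) {k : ℕ} (level : IsLevel k 𝓕) where
    open Positions 𝓕 distinct

    -- Completeness of the level puts every lattice element of rank k among the positions of the
    -- family.
    level-length : k < n → length 𝓕 ≡ gauss q n k
    level-length k<n = trans (sym size) (trans
      (#-cong member? (level? k)
        (λ { _ (i , refl) → rk-index (List.lookup 𝓕 i) (proj₁ level i) })
        (λ x e → let i , W≐ = proj₂ level (S x) (subst (HasDim (S x)) e (rk-dim x))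
                 in i , S-injective (pos i) x (≐-trans (S (pos i)) (List.lookup 𝓕 i) (S x) (pos-≐ i) W≐)))
      (level-size k k<n))

    level-antichain : ∀ i j → List.lookup 𝓕 i ⊆ˢ List.lookup 𝓕 j → i ≡ j
    level-antichain i j le with i ≟ᶠ j
    ... | yes i≡j = i≡j
    ... | no  i≢j = contradiction
      (⊆-≐ (List.lookup 𝓕 i) (List.lookup 𝓕 j) (proj₁ level i) (proj₁ level j) le) (distinct i j i≢j)

    -- One leaf exists because u and v are positive, and comparability with the centre would make it
    -- equal to the centre.
    level-free : ∀ {u v} → u ≥ 1 → v ≥ 1 → BroomForkFree u v 𝓕
    level-free (s≤s _) (s≤s _) = distinct ,
      (λ (θ , inj , le) → contradiction (inj (level-antichain _ _ (le zero))) λ ()) ,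
      (λ (θ , inj , le) → contradiction (inj (level-antichain _ _ (le zero))) λ ())

theoremB : ∀ (n m : ℕ) → n ≡ 2 * m → m ≥ 1 →
    ∀ (q : ℕ) (F : FiniteField q) (u v : ℕ) → u ≥ 1 → v ≥ 1 → u ≤ q → v ≤ q →
    let open VectorSpace F n in
    (∃ λ 𝓕 → IsLevel m 𝓕 × BroomForkFree u v 𝓕 × length 𝓕 ≡ gauss q n m)
    × (∀ 𝓕 → BroomForkFree u v 𝓕 → length 𝓕 ≤ gauss q n m)
    × (∀ 𝓕 → BroomForkFree u v 𝓕 → length 𝓕 ≡ gauss q n m → IsLevel m 𝓕)
theoremB n m n≡2m m≥1 q F u v u≥1 v≥1 u≤q v≤q =
  ( levelFamily m
  , levelFamily-isLevel m
  , level-free (levelFamily m) (levelFamily-distinct m) (levelFamily-isLevel m) u≥1 v≥1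
  , level-length (levelFamily m) (levelFamily-distinct m) (levelFamily-isLevel m) m<n )
  , length-bound
  , full-is-level
  where
  open Families F n
  open Bound m (trans n≡2m (cong (m +_) (+-identityʳ m))) m≥1 u≤q v≤q
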